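{- Let $G=(V,E)$ be an $n$-vertex undirected capacitated network of treewidth $t$ with a terminal set $K\subset V$ of size $k$. Then one can create a mimicking network for $(G,K)$ that has size at most $k\, 2^{\binom{3(t+1)}{\lfloor 3(t+1)/2\rfloor}}$.
   Context: Graphs are finite, undirected, with edge capacities $c:E\to\mathbb{R}^+$. The cut function is $h_G(A)=\sum_{e\in\delta(A)}c(e)$ for $A\subseteq V$, where $\delta(A)$ is the set of edges with exactly one endpoint in $A$. For $U\subseteq K$, the terminal cut function is $h_K^G(U)=\min\{h_G(A): A\subseteq V,\ A\cap K=U\}$. A mimicking network for $(G,K)$ is an undirected capacitated graph $H=(V_H,E_H)$ with $K\subseteq V_H$ such that $h_K^H(U)=h_K^G(U)$ for every $U\subset K$. The size of a mimicking network is its number of vertices. -}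

module Defs where

open import Algebra.Bundles using (module CommutativeMonoid)
import Algebra.Properties.CommutativeSemigroup as CommutativeSemigroupProperties
open import Data.Bool.Properties using () renaming (_≟_ to _≟ᵇ_)
open import Data.Fin using (Fin) renaming (_<_ to _<ᶠ_)
open import Data.Fin.Properties using () renaming (_<?_ to _<ᶠ?_)
open import Data.Fin.Subset using (Subset; _∈_; ∣_∣)
open import Data.List using (List; []; _∷_; _∷ʳ_; map; filter; foldr; length; allFin; cartesianProduct)
open import Data.List.Relation.Unary.Linked using (Linked)
open import Data.List.Relation.Unary.Unique.Propositional using (Unique)
open import Data.Nat as ℕ using (ℕ; suc)
import Data.Nat.Properties as ℕₚ
open import Data.Product using (Σ; ∃-syntax; _×_; _,_; uncurry)
open import Data.Rational as ℚ using (ℚ; 0ℚ; ½)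
import Data.Rational.Properties as ℚₚ
open import Data.Vec using (lookup)
open import Function.Bundles using (_⇔_; _↣_; Injection)
open import Level using (0ℓ)
open import Relation.Binary.Core using (Rel)
open import Relation.Binary.Definitions using (Decidable; Symmetric; Irreflexive)
open import Relation.Binary.Construct.Closure.ReflexiveTransitive using (Star)
open import Relation.Binary.PropositionalEquality using (_≡_; _≢_; sym; trans; cong; subst)
open import Relation.Nullary using (¬_)
open import Relation.Nullary.Decidable using (¬?; _×-dec_)
import Relation.Unary as U

private
  module ℚ+ₚ = CommutativeSemigroupProperties
    (CommutativeMonoid.commutativeSemigroup ℚₚ.+-0-commutativeMonoid)

-- Real numbers: Cauchy sequences of rationals, up to _≃_.

IsCauchy : (ℕ → ℚ) → Set
IsCauchy s = ∀ ε → 0ℚ ℚ.< ε →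
  ∃[ N ] (∀ m n → N ℕ.≤ m → N ℕ.≤ n → ℚ.∣ s m ℚ.- s n ∣ ℚ.< ε)

record ℝ : Set where
  constructor mkℝ
  field
    seq    : ℕ → ℚ
    cauchy : IsCauchy seq

open ℝ public

Eventually : (ℕ → Set) → Set
Eventually P = ∃[ N ] (∀ n → N ℕ.≤ n → P n)

infix 4 _≃_ _≤ᴿ_ _<ᴿ_
infixl 6 _+ᴿ_

_≃_ : Rel ℝ 0ℓ
x ≃ y = ∀ ε → 0ℚ ℚ.< ε → Eventually λ n → ℚ.∣ seq x n ℚ.- seq y n ∣ ℚ.< ε

_≤ᴿ_ : Rel ℝ 0ℓ
x ≤ᴿ y = ∀ ε → 0ℚ ℚ.< ε → Eventually λ n → seq x n ℚ.≤ seq y n ℚ.+ ε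

_<ᴿ_ : Rel ℝ 0ℓ
x <ᴿ y = ∃[ ε ] (0ℚ ℚ.< ε × Eventually λ n → seq x n ℚ.+ ε ℚ.≤ seq y n)

0ᴿ : ℝ
0ᴿ = mkℝ (λ _ → 0ℚ) (λ ε 0<ε → 0 , λ _ _ _ _ → 0<ε)

_+ᴿ_ : ℝ → ℝ → ℝ
x +ᴿ y = mkℝ s s-cauchy
  where
  s : ℕ → ℚ
  s n = seq x n ℚ.+ seq y n

  regroup : ∀ a b c d → (a ℚ.+ b) ℚ.- (c ℚ.+ d) ≡ (a ℚ.- c) ℚ.+ (b ℚ.- d)
  regroup a b c d =
    trans (cong ((a ℚ.+ b) ℚ.+_) (ℚₚ.neg-distrib-+ c d))
          (ℚ+ₚ.interchange a b (ℚ.- c) (ℚ.- d))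

  halves : ∀ ε → ½ ℚ.* ε ℚ.+ ½ ℚ.* ε ≡ ε
  halves ε = trans (sym (ℚₚ.*-distribʳ-+ ε ½ ½)) (ℚₚ.*-identityˡ ε)

  s-cauchy : IsCauchy s
  s-cauchy ε 0<ε
    with cauchy x (½ ℚ.* ε) 0<½ε | cauchy y (½ ℚ.* ε) 0<½ε
    where
    0<½ε : 0ℚ ℚ.< ½ ℚ.* ε
    0<½ε = subst (ℚ._< ½ ℚ.* ε) (ℚₚ.*-zeroʳ ½) (ℚₚ.*-monoʳ-<-pos ½ 0<ε)
  ... | M , p | N , q = M ℕ.⊔ N , λ m n m≥ n≥ →
    let a = seq x m ; b = seq y m ; c = seq x n ; d = seq y n in
    subst (λ z → ℚ.∣ z ∣ ℚ.< ε) (sym (regroup a b c d))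
      (ℚₚ.≤-<-trans (ℚₚ.∣p+q∣≤∣p∣+∣q∣ (a ℚ.- c) (b ℚ.- d))
        (subst (ℚ.∣ a ℚ.- c ∣ ℚ.+ ℚ.∣ b ℚ.- d ∣ ℚ.<_) (halves ε)
          (ℚₚ.+-mono-<
            (p m n (ℕₚ.m⊔n≤o⇒m≤o M N m≥) (ℕₚ.m⊔n≤o⇒m≤o M N n≥))
            (q m n (ℕₚ.m⊔n≤o⇒n≤o M N m≥) (ℕₚ.m⊔n≤o⇒n≤o M N n≥)))))

sumᴿ : List ℝ → ℝ
sumᴿ = foldr _+ᴿ_ 0ᴿ

-- Finite simple undirected graphs with vertex set Fin n.
record Graph (n : ℕ) : Set₁ where
  field
    Adj        : Rel (Fin n) 0ℓ
    adj?       : Decidable Adj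
    adj-sym    : Symmetric Adj
    adj-irrefl : Irreflexive _≡_ Adj

  -- Each edge is listed once, with its smaller endpoint first.
  edges : List (Fin n × Fin n)
  edges = filter (λ (u , v) → (u <ᶠ? v) ×-dec adj? u v)
                 (cartesianProduct (allFin n) (allFin n))

  Connected : Set
  Connected = ∀ u v → Star Adj u v

  -- The closed walk x, vs, x is a cycle of length at least three.
  IsCycle : Fin n → List (Fin n) → Set
  IsCycle x vs = Unique (x ∷ vs) × Linked Adj (x ∷ vs ∷ʳ x) × 2 ℕ.≤ length vs

  Acyclic : Set
  Acyclic = ∀ x vs → ¬ IsCycle x vs

record IsTree {m : ℕ} (T : Graph m) : Set where
  open Graph T
  field
    nonempty  : 1 ℕ.≤ m
    connected : Connected
    acyclic   : Acyclic

record TreeDecomposition {n : ℕ} (G : Graph n) : Set₁ where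
  field
    size   : ℕ
    tree   : Graph size
    isTree : IsTree tree
    bag    : Fin size → Subset n
    covers-vertices : ∀ v → ∃[ i ] v ∈ bag i
    covers-edges    : ∀ u v → Graph.Adj G u v → ∃[ i ] (u ∈ bag i × v ∈ bag i)
    -- The nodes whose bags contain v induce a connected subgraph of the tree.
    coherent : ∀ v i j → v ∈ bag i → v ∈ bag j →
      Star (λ a b → Graph.Adj tree a b × v ∈ bag a × v ∈ bag b) i j

-- The width max |bag| - 1 equals w.
HasWidth : ∀ {n} {G : Graph n} → TreeDecomposition G → ℕ → Set
HasWidth D w = (∀ i → ∣ bag i ∣ ℕ.≤ suc w) × (∃[ i ] ∣ bag i ∣ ≡ suc w)
  where open TreeDecomposition D

HasTreewidth : ∀ {n} → Graph n → ℕ → Set₁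
HasTreewidth G t =
  (Σ (TreeDecomposition G) λ D → HasWidth D t) ×
  (∀ (D : TreeDecomposition G) w → HasWidth D w → t ℕ.≤ w)

-- The values of cap on non-adjacent pairs play no role.
record Network (n : ℕ) : Set₁ where
  field
    graph : Graph n
  open Graph graph public
  field
    cap     : Fin n → Fin n → ℝ
    cap-sym : ∀ u v → Adj u v → cap u v ≃ cap v u
    cap-pos : ∀ u v → Adj u v → 0ᴿ <ᴿ cap u v

  Crosses : Subset n → Fin n × Fin n → Set
  Crosses A (u , v) = lookup A u ≢ lookup A v

  crosses? : ∀ A → U.Decidable (Crosses A)
  crosses? A (u , v) = ¬? (lookup A u ≟ᵇ lookup A v)

  δ : Subset n → List (Fin n × Fin n)
  δ A = filter (crosses? A) edges

  cut : Subset n → ℝ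
  cut A = sumᴿ (map (uncurry cap) (δ A))

-- A terminal set K of size k in Fin n is given by an injection τ : Fin k ↣ Fin n
-- with image K, so that the same k terminals can lie in several networks;
-- a set U ⊆ K of terminals is then a Subset k.

-- A ∩ K = U
Extends : ∀ {k n} → (Fin k ↣ Fin n) → Subset k → Subset n → Set
Extends τ U A = ∀ i → (Injection.to τ i ∈ A) ⇔ (i ∈ U)

-- m is the value at U of the terminal cut function.
record IsTerminalCut {k n} (G : Network n) (τ : Fin k ↣ Fin n) (U : Subset k) (m : ℝ) : Set where
  open Network G
  field
    attained : ∃[ A ] (Extends τ U A × cut A ≃ m)
    minimal  : ∀ A → Extends τ U A → m ≤ᴿ cut A

-- (H , σ) is a mimicking network for (G , τ), the i-th terminals σ i and τ i being identified.
-- The existential asserts that both minima exist and are equal.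
IsMimicking : ∀ {k n N} → Network n → (Fin k ↣ Fin n) → Network N → (Fin k ↣ Fin N) → Set
IsMimicking {k} G τ H σ = ∀ (U : Subset k) →
  ∃[ m ] (IsTerminalCut G τ U m × IsTerminalCut H σ U m)

{-# OPTIONS --safe #-}
module Submission where

-- Contract the vertices of G along a map q for which every set of terminals has a minimum cut
-- that is a union of classes of q.  To find q, cut the decomposition tree at the bags holding
-- the terminals and at medians of these into at most 2k + 1 pieces, each attached to the rest
-- of the tree through at most two nodes.  The cost of a cut is the sum of its costs in the
-- pieces, so once the trace of a cut on the two end bags of a piece is known, the cut may be
-- replaced inside the piece by one fixed optimal choice for that trace.  A vertex is then
-- described by its piece and by its side in each of these 2^(2(t+1)) choices, which gives at
-- most (2k + 1) 2^(4^(t+1)) classes.  For t ≥ 1 this is small enough since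
-- 2 + 4^s ≤ C(3s, ⌊3s/2⌋) for s ≥ 2; for t = 0 there are no edges at all.

open import Defs
open import Algebra.Bundles using (CommutativeMonoid)
import Algebra.Properties.CommutativeSemigroup as CommutativeSemigroupProperties
open import Algebra.Structures using (IsCommutativeMonoid)
open import Axiom.ExcludedMiddle using (ExcludedMiddle)
open import Data.Bool using (Bool; false; true)
open import Data.Bool.Properties using () renaming (_≟_ to _≟ᵇ_)
open import Data.Empty using (⊥; ⊥-elim)
open import Data.Fin as Fin using (Fin; _↑ʳ_; _↑ˡ_; combine; finToFun; funToFin; splitAt; suc; zero)
open import Data.Fin.Properties as Finₚ using ()
open import Data.Fin.Subset using (Subset; _∈_; ⁅_⁆; ∣_∣)
open import Data.Fin.Subset.Properties using (x∈⁅x⁆; x∈⁅y⁆⇒x≡y)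
open import Data.List using (List; []; _∷_; _∷ʳ_; allFin; cartesianProduct; filter; foldr; length; map)
import Data.List.Membership.Propositional as List∈
import Data.List.Membership.Propositional.Properties as List∈ₚ
open import Data.List.Relation.Unary.All as All using (All; []; _∷_)
open import Data.List.Relation.Unary.All.Properties using (¬Any⇒All¬)
open import Data.List.Relation.Unary.AllPairs using ([]; _∷_)
open import Data.List.Relation.Unary.Any using (any?; here; there)
open import Data.List.Relation.Unary.Linked using (Linked; [-]; []; _∷_)
open import Data.List.Relation.Unary.Unique.Propositional using (Unique)
import Data.List.Relation.Unary.Unique.Propositional.Properties as Uniqueₚ
open import Data.Nat as ℕ using (_*_; _+_; _/_; _<_; _^_; _≤_; suc; s≤s; zero; z≤n; ℕ)
open import Data.Nat.Combinatorics using (_C_; nCk+nC[k+1]≡[n+1]C[k+1]; nCk≡nC[n∸k])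
open import Data.Nat.DivMod using (m*n/n≡m; m/n≡1+[m∸n]/n)
open import Data.Nat.Induction using (<-wellFounded)
import Data.Nat.Properties as ℕₚ
open import Data.Nat.Tactic.RingSolver using (solve-∀)
open import Data.Product using (_,_; _×_; proj₁; proj₂; uncurry; Σ; ∃; ∃-syntax)
open import Data.Rational as ℚ using (0ℚ; ½; ℚ)
import Data.Rational.Properties as ℚₚ
import Data.Rational.Solver as ℚ-Solver
open import Data.Sum using ([_,_]′; _⊎_; inj₁; inj₂; swap)
open import Data.Vec as Vec using ([]; _∷_; here; lookup; tabulate; there)
import Data.Vec.Properties as Vecₚ
open import Function.Base using (_∘_; id)
open import Function.Bundles using (Equivalence; Injection; _↣_; mk↣; mk⇔)
open import Induction.WellFounded using (Acc; acc)
open import Level using (0ℓ)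
open import Relation.Binary.Construct.Closure.ReflexiveTransitive as Star using (Star; _◅_; _◅◅_)
open import Relation.Binary.Core using (Rel)
open import Relation.Binary.Definitions using (Tri; tri<; tri>; tri≈)
open import Relation.Binary.PropositionalEquality using (_≡_; _≢_; cong; cong₂; refl; subst; subst₂; sym; trans)
import Relation.Binary.Reasoning.Setoid as SetoidReasoning
open import Relation.Binary.Structures using (IsEquivalence; IsTotalPreorder)
open import Relation.Nullary using (Dec; no; yes; ¬_)
open import Relation.Nullary.Decidable using (_×-dec_; _⊎-dec_; ¬?)
import Relation.Unary as U

-- One quotient must serve all terminal sets at once, so the choice made inside a piece may depend
-- on the trace of the cut but not on the terminal set. Putting together the choices of different
-- pieces is consistent because an endpoint of an edge that counts for a foreign piece lies in end
-- bags of both pieces, where every choice for the right trace agrees with the original cut.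
-- Terminals keep their sides for the same reason: each is in an end bag of its own piece. Medians
-- keep the number of ends at two. A new marked node inside a piece with ends `x` and `y` would be a
-- third end; removing the median of the three separates them from one another, so each part needs
-- only its own apex and the median as ends. Hence every terminal adds two pieces to the initial
-- one. The 2 in `2 + 4^s` pays for the number of pieces, as 2k + 1 ≤ 4k. For s = 1 the inequality
-- fails, 6 against 3, which is why t = 0 stands apart. Excluded middle serves to compare reals and
-- to decide on which side of a node another node lies.

-- Addition and order of Cauchy reals

module _ where
  open ℚ-Solver.+-*-Solver

  halves : ∀ ε → ½ ℚ.* ε ℚ.+ ½ ℚ.* ε ≡ ε
  halves = solve 1 (λ ε → con ½ :* ε :+ con ½ :* ε := ε) refl

  p≡q+[p-q] : ∀ p q → p ≡ q ℚ.+ (p ℚ.- q)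
  p≡q+[p-q] = solve 2 (λ p q → p := q :+ (p :- q)) refl

  q+r-q≡r : ∀ q r → (q ℚ.+ r) ℚ.- q ≡ r
  q+r-q≡r = solve 2 (λ q r → (q :+ r) :- q := r) refl

  +-interchange : ∀ p q r s → (p ℚ.+ q) ℚ.+ (r ℚ.+ s) ≡ (p ℚ.+ r) ℚ.+ (q ℚ.+ s)
  +-interchange = solve 4 (λ p q r s → (p :+ q) :+ (r :+ s) := (p :+ r) :+ (q :+ s)) refl

0<½* : ∀ {ε} → 0ℚ ℚ.< ε → 0ℚ ℚ.< ½ ℚ.* ε
0<½* {ε} 0<ε = subst (ℚ._< ½ ℚ.* ε) (ℚₚ.*-zeroʳ ½) (ℚₚ.*-monoʳ-<-pos ½ 0<ε)

½*< : ∀ {ε} → 0ℚ ℚ.< ε → ½ ℚ.* ε ℚ.< ε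
½*< {ε} 0<ε = subst₂ ℚ._<_ (ℚₚ.+-identityˡ _) (halves ε) (ℚₚ.+-monoˡ-< (½ ℚ.* ε) (0<½* 0<ε))

≤+pos : ∀ {p q ε} → 0ℚ ℚ.< ε → p ℚ.≤ q → p ℚ.≤ q ℚ.+ ε
≤+pos {p} {q} 0<ε p≤q =
  subst (ℚ._≤ q ℚ.+ _) (ℚₚ.+-identityʳ p) (ℚₚ.+-mono-≤ p≤q (ℚₚ.<⇒≤ 0<ε))

p≤∣p∣ : ∀ p → p ℚ.≤ ℚ.∣ p ∣
p≤∣p∣ p with ℚₚ.≤-total 0ℚ p
... | inj₁ 0≤p = ℚₚ.≤-reflexive (sym (ℚₚ.0≤p⇒∣p∣≡p 0≤p))
... | inj₂ p≤0 = ℚₚ.≤-trans p≤0 (ℚₚ.0≤∣p∣ p)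

∣p-q∣≡∣q-p∣ : ∀ p q → ℚ.∣ p ℚ.- q ∣ ≡ ℚ.∣ q ℚ.- p ∣
∣p-q∣≡∣q-p∣ p q = trans (cong ℚ.∣_∣ (lemma p q)) (ℚₚ.∣-p∣≡∣p∣ (q ℚ.- p))
  where
  open ℚ-Solver.+-*-Solver
  lemma : ∀ p q → p ℚ.- q ≡ ℚ.- (q ℚ.- p)
  lemma = solve 2 (λ p q → p :- q := :- (q :- p)) refl

∣p-q∣<ε⇒p≤q+ε : ∀ {p q ε} → ℚ.∣ p ℚ.- q ∣ ℚ.< ε → p ℚ.≤ q ℚ.+ ε
∣p-q∣<ε⇒p≤q+ε {p} {q} {ε} lt = subst (ℚ._≤ q ℚ.+ ε) (sym (p≡q+[p-q] p q))
  (ℚₚ.+-monoʳ-≤ q (ℚₚ.≤-trans (p≤∣p∣ (p ℚ.- q)) (ℚₚ.<⇒≤ lt)))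

p≤q+ε⇒p-q≤ε : ∀ {p q ε} → p ℚ.≤ q ℚ.+ ε → p ℚ.- q ℚ.≤ ε
p≤q+ε⇒p-q≤ε {p} {q} {ε} le = subst (p ℚ.- q ℚ.≤_) (q+r-q≡r q ε) (ℚₚ.+-monoˡ-≤ (ℚ.- q) le)

∣p-q∣≤ε : ∀ {p q ε} → p ℚ.≤ q ℚ.+ ε → q ℚ.≤ p ℚ.+ ε → ℚ.∣ p ℚ.- q ∣ ℚ.≤ ε
∣p-q∣≤ε {p} {q} {ε} p≤ q≤ with ℚₚ.≤-total 0ℚ (p ℚ.- q)
... | inj₁ 0≤ = subst (ℚ._≤ ε) (sym (ℚₚ.0≤p⇒∣p∣≡p 0≤)) (p≤q+ε⇒p-q≤ε p≤)
... | inj₂ ≤0 = subst (ℚ._≤ ε) (sym (trans (∣p-q∣≡∣q-p∣ p q) (ℚₚ.0≤p⇒∣p∣≡p 0≤q-p))) (p≤q+ε⇒p-q≤ε q≤)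
  where
  open ℚ-Solver.+-*-Solver
  0≤q-p : 0ℚ ℚ.≤ q ℚ.- p
  0≤q-p = subst (0ℚ ℚ.≤_) (solve 2 (λ p q → :- (p :- q) := q :- p) refl p q) (ℚₚ.neg-antimono-≤ ≤0)

Eventually-map : ∀ {P Q : ℕ → Set} → (∀ n → P n → Q n) → Eventually P → Eventually Q
Eventually-map f (N , p) = N , λ n N≤n → f n (p n N≤n)

Eventually-× : ∀ {P Q : ℕ → Set} → Eventually P → Eventually Q → Eventually (λ n → P n × Q n)
Eventually-× (M , p) (N , q) = M ℕ.⊔ N , λ n le →
  p n (ℕₚ.m⊔n≤o⇒m≤o M N le) , q n (ℕₚ.m⊔n≤o⇒n≤o M N le)

≤ᴿ-pointwise : ∀ {x y} → (∀ n → seq x n ℚ.≤ seq y n) → x ≤ᴿ y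
≤ᴿ-pointwise le ε 0<ε = 0 , λ n _ → ≤+pos 0<ε (le n)

≤ᴿ-trans : ∀ {x y z} → x ≤ᴿ y → y ≤ᴿ z → x ≤ᴿ z
≤ᴿ-trans {x} {y} {z} x≤y y≤z ε 0<ε =
  Eventually-map (λ n (p , q) → ℚₚ.≤-trans p
      (subst (seq y n ℚ.+ ½ ℚ.* ε ℚ.≤_)
        (trans (ℚₚ.+-assoc (seq z n) _ _) (cong (seq z n ℚ.+_) (halves ε)))
        (ℚₚ.+-monoˡ-≤ (½ ℚ.* ε) q)))
    (Eventually-× (x≤y (½ ℚ.* ε) (0<½* 0<ε)) (y≤z (½ ℚ.* ε) (0<½* 0<ε)))

+ᴿ-mono-≤ᴿ : ∀ {x y u v} → x ≤ᴿ y → u ≤ᴿ v → x +ᴿ u ≤ᴿ y +ᴿ v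
+ᴿ-mono-≤ᴿ {x} {y} {u} {v} x≤y u≤v ε 0<ε =
  Eventually-map (λ n (p , q) →
      subst (seq x n ℚ.+ seq u n ℚ.≤_)
        (trans (+-interchange (seq y n) _ (seq v n) _) (cong ((seq y n ℚ.+ seq v n) ℚ.+_) (halves ε)))
        (ℚₚ.+-mono-≤ p q))
    (Eventually-× (x≤y (½ ℚ.* ε) (0<½* 0<ε)) (u≤v (½ ℚ.* ε) (0<½* 0<ε)))

≃⇒≤ᴿ : ∀ {x y} → x ≃ y → x ≤ᴿ y
≃⇒≤ᴿ x≃y ε 0<ε = Eventually-map (λ n → ∣p-q∣<ε⇒p≤q+ε) (x≃y ε 0<ε)

≃-sym : ∀ {x y} → x ≃ y → y ≃ x
≃-sym {x} {y} x≃y ε 0<ε =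
  Eventually-map (λ n → subst (ℚ._< ε) (∣p-q∣≡∣q-p∣ (seq x n) (seq y n))) (x≃y ε 0<ε)

≤ᴿ-antisym : ∀ {x y} → x ≤ᴿ y → y ≤ᴿ x → x ≃ y
≤ᴿ-antisym x≤y y≤x ε 0<ε =
  Eventually-map (λ n (p , q) → ℚₚ.≤-<-trans (∣p-q∣≤ε p q) (½*< 0<ε))
    (Eventually-× (x≤y (½ ℚ.* ε) (0<½* 0<ε)) (y≤x (½ ℚ.* ε) (0<½* 0<ε)))

≃-pointwise : ∀ {x y} → (∀ n → seq x n ≡ seq y n) → x ≃ y
≃-pointwise {x} {y} eq = ≤ᴿ-antisym {x} {y} (≤ᴿ-pointwise {x} {y} (λ n → ℚₚ.≤-reflexive (eq n)))
  (≤ᴿ-pointwise {y} {x} (λ n → ℚₚ.≤-reflexive (sym (eq n))))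

≃-isEquivalence : IsEquivalence _≃_
≃-isEquivalence = record
  { refl  = λ {x} → ≃-pointwise {x} {x} (λ _ → refl)
  ; sym   = λ {x} {y} → ≃-sym {x} {y}
  ; trans = λ {x} {y} {z} x≃y y≃z → ≤ᴿ-antisym {x} {z}
      (≤ᴿ-trans {x} {y} {z} (≃⇒≤ᴿ {x} {y} x≃y) (≃⇒≤ᴿ {y} {z} y≃z))
      (≤ᴿ-trans {z} {y} {x} (≃⇒≤ᴿ {z} {y} (≃-sym {y} {z} y≃z)) (≃⇒≤ᴿ {y} {x} (≃-sym {x} {y} x≃y)))
  }

+ᴿ-0-isCommutativeMonoid : IsCommutativeMonoid _≃_ _+ᴿ_ 0ᴿ
+ᴿ-0-isCommutativeMonoid = record
  { isMonoid = record
    { isSemigroup = record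
      { isMagma = record
        { isEquivalence = ≃-isEquivalence
        ; ∙-cong = λ {x} {y} {u} {v} x≃y u≃v → ≤ᴿ-antisym {x +ᴿ u} {y +ᴿ v}
            (+ᴿ-mono-≤ᴿ {x} {y} {u} {v} (≃⇒≤ᴿ {x} {y} x≃y) (≃⇒≤ᴿ {u} {v} u≃v))
            (+ᴿ-mono-≤ᴿ {y} {x} {v} {u} (≃⇒≤ᴿ {y} {x} (≃-sym {x} {y} x≃y))
              (≃⇒≤ᴿ {v} {u} (≃-sym {u} {v} u≃v)))
        }
      ; assoc = λ x y z → ≃-pointwise {(x +ᴿ y) +ᴿ z} {x +ᴿ (y +ᴿ z)}
          (λ n → ℚₚ.+-assoc (seq x n) (seq y n) (seq z n))
      }
    ; identity = (λ x → ≃-pointwise {0ᴿ +ᴿ x} {x} (λ n → ℚₚ.+-identityˡ (seq x n)))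
               , (λ x → ≃-pointwise {x +ᴿ 0ᴿ} {x} (λ n → ℚₚ.+-identityʳ (seq x n)))
    }
  ; comm = λ x y → ≃-pointwise {x +ᴿ y} {y +ᴿ x} (λ n → ℚₚ.+-comm (seq x n) (seq y n))
  }

ℝ-+-commutativeMonoid : CommutativeMonoid 0ℓ 0ℓ
ℝ-+-commutativeMonoid = record { isCommutativeMonoid = +ᴿ-0-isCommutativeMonoid }

-- If x ≰ y then seq x n > seq y n + ε for some arbitrarily late n; the Cauchy property
-- spreads this to all late indices, at the cost of ε.
≤ᴿ-total : ExcludedMiddle 0ℓ → ∀ x y → x ≤ᴿ y ⊎ y ≤ᴿ x
≤ᴿ-total em x y with em {x ≤ᴿ y}
... | yes x≤y = inj₁ x≤y
... | no  x≰y = inj₂ (y≤x witness)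
  where
  Fails : ℚ → Set
  Fails ε = 0ℚ ℚ.< ε × ¬ Eventually (λ n → seq x n ℚ.≤ seq y n ℚ.+ ε)

  witness : ∃ Fails
  witness with em {∃ Fails}
  ... | yes w = w
  ... | no ¬w = ⊥-elim (x≰y λ ε 0<ε → late ε 0<ε)
    where
    late : ∀ ε → 0ℚ ℚ.< ε → Eventually (λ n → seq x n ℚ.≤ seq y n ℚ.+ ε)
    late ε 0<ε with em {Eventually (λ n → seq x n ℚ.≤ seq y n ℚ.+ ε)}
    ... | yes p = p
    ... | no ¬p = ⊥-elim (¬w (ε , 0<ε , ¬p))

  y≤x : ∃ Fails → y ≤ᴿ x
  y≤x (ε , 0<ε , fails)
    with cauchy x (½ ℚ.* ε) (0<½* 0<ε) | cauchy y (½ ℚ.* ε) (0<½* 0<ε)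
  ... | M , x-close | N , y-close with em {∃[ n ] (M ℕ.⊔ N ℕ.≤ n × seq y n ℚ.+ ε ℚ.< seq x n)}
  ...   | no ¬late = ⊥-elim (fails (M ℕ.⊔ N , λ n le → ℚₚ.≮⇒≥ (λ lt → ¬late (n , le , lt))))
  ...   | yes (n , le , lt) = λ ε′ 0<ε′ → M ℕ.⊔ N , λ m le′ → ≤+pos 0<ε′
    (bound m (x-close n m (ℕₚ.m⊔n≤o⇒m≤o M N le) (ℕₚ.m⊔n≤o⇒m≤o M N le′))
             (y-close m n (ℕₚ.m⊔n≤o⇒n≤o M N le′) (ℕₚ.m⊔n≤o⇒n≤o M N le)))
    where
    h = ½ ℚ.* ε
    open ℚₚ.≤-Reasoning
    bound : ∀ m → ℚ.∣ seq x n ℚ.- seq x m ∣ ℚ.< h → ℚ.∣ seq y m ℚ.- seq y n ∣ ℚ.< h →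
            seq y m ℚ.≤ seq x m
    bound m x≈ y≈ = ℚₚ.≮⇒≥ λ xm<ym → ℚₚ.<-irrefl refl (begin-strict
      seq x n                       ≤⟨ ∣p-q∣<ε⇒p≤q+ε x≈ ⟩
      seq x m ℚ.+ h                 <⟨ ℚₚ.+-monoˡ-< h xm<ym ⟩
      seq y m ℚ.+ h                 ≤⟨ ℚₚ.+-monoˡ-≤ h (∣p-q∣<ε⇒p≤q+ε {seq y m} {seq y n} y≈) ⟩
      (seq y n ℚ.+ h) ℚ.+ h         ≡⟨ ℚₚ.+-assoc (seq y n) h h ⟩
      seq y n ℚ.+ (h ℚ.+ h)         ≡⟨ cong (seq y n ℚ.+_) (halves ε) ⟩
      seq y n ℚ.+ ε                 <⟨ lt ⟩
      seq x n                       ∎)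

≤ᴿ-isTotalPreorder : ExcludedMiddle 0ℓ → IsTotalPreorder _≃_ _≤ᴿ_
≤ᴿ-isTotalPreorder em = record
  { isPreorder = record
    { isEquivalence = ≃-isEquivalence
    ; reflexive     = λ {x} {y} → ≃⇒≤ᴿ {x} {y}
    ; trans         = λ {x} {y} {z} → ≤ᴿ-trans {x} {y} {z}
    }
  ; total = ≤ᴿ-total em
  }

<ᴿ⇒≤ᴿ : ∀ {x y} → x <ᴿ y → x ≤ᴿ y
<ᴿ⇒≤ᴿ {x} {y} (ε , 0<ε , lt) ε′ 0<ε′ = Eventually-map (λ n le → ≤+pos 0<ε′
  (ℚₚ.≤-trans (≤+pos 0<ε (ℚₚ.≤-refl {seq x n})) le)) lt

<ᴿ-≤ᴿ-trans : ∀ {x y z} → x <ᴿ y → y ≤ᴿ z → x <ᴿ z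
<ᴿ-≤ᴿ-trans {x} {y} {z} (ε , 0<ε , lt) y≤z = ½ ℚ.* ε , 0<½* 0<ε ,
  Eventually-map (λ n (p , q) → lemma (seq x n) (seq y n) (seq z n) p q)
    (Eventually-× lt (y≤z (½ ℚ.* ε) (0<½* 0<ε)))
  where
  h = ½ ℚ.* ε
  lemma : ∀ a b c → a ℚ.+ ε ℚ.≤ b → b ℚ.≤ c ℚ.+ h → a ℚ.+ h ℚ.≤ c
  lemma a b c p q = begin
    a ℚ.+ h                     ≡⟨ q+r-q≡r h (a ℚ.+ h) ⟨
    (h ℚ.+ (a ℚ.+ h)) ℚ.- h     ≡⟨ cong (ℚ._- h) (shuffle a ε) ⟩
    (a ℚ.+ ε) ℚ.- h             ≤⟨ ℚₚ.+-monoˡ-≤ (ℚ.- h) p ⟩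
    b ℚ.- h                     ≤⟨ ℚₚ.+-monoˡ-≤ (ℚ.- h) q ⟩
    (c ℚ.+ h) ℚ.- h             ≡⟨ cong (ℚ._- h) (ℚₚ.+-comm c h) ⟩
    (h ℚ.+ c) ℚ.- h             ≡⟨ q+r-q≡r h c ⟩
    c                           ∎
    where
    open ℚₚ.≤-Reasoning
    open ℚ-Solver.+-*-Solver
    shuffle : ∀ a ε → ½ ℚ.* ε ℚ.+ (a ℚ.+ ½ ℚ.* ε) ≡ a ℚ.+ ε
    shuffle = solve 2 (λ a ε → con ½ :* ε :+ (a :+ con ½ :* ε) := a :+ ε) refl

-- Finite sums in a totally preordered commutative monoid

-- The exchange argument only adds and compares costs; totality of the comparison is what gives a
-- minimiser among finitely many cuts.
record TotallyPreorderedMonoid : Set₁ where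
  field
    commutativeMonoid : CommutativeMonoid 0ℓ 0ℓ
  open CommutativeMonoid commutativeMonoid public
    using (Carrier; _≈_; _∙_; ∙-cong; ∙-congˡ; identityˡ; identityʳ; setoid; commutativeSemigroup)
    renaming (ε to 𝟘; refl to ≈-refl; sym to ≈-sym; trans to ≈-trans; reflexive to ≈-reflexive)
  field
    _≼_             : Rel Carrier 0ℓ
    isTotalPreorder : IsTotalPreorder _≈_ _≼_
    ∙-mono          : ∀ {x y u v} → x ≼ y → u ≼ v → (x ∙ u) ≼ (y ∙ v)
  open IsTotalPreorder isTotalPreorder public
    using (total) renaming (reflexive to ≼-reflexive; trans to ≼-trans)

module Sums (O : TotallyPreorderedMonoid) where
  open TotallyPreorderedMonoid O
  open CommutativeSemigroupProperties commutativeSemigroup using (interchange)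
  open SetoidReasoning setoid

  private variable
    A B P Q : Set

  ∑ : (A → Carrier) → List A → Carrier
  ∑ f xs = foldr _∙_ 𝟘 (map f xs)

  infixl 5 _when_
  -- An indicator factor. It turns a sum over a filtered list into a sum over a fixed one, so that
  -- double sums can be interchanged.
  _when_ : Carrier → Dec P → Carrier
  x when yes _ = x
  x when no  _ = 𝟘

  when-yes : ∀ x (P? : Dec P) → P → x when P? ≡ x
  when-yes x (yes _) p = refl
  when-yes x (no ¬p) p = ⊥-elim (¬p p)

  when-no : ∀ x (P? : Dec P) → ¬ P → x when P? ≡ 𝟘
  when-no x (yes p) ¬p = ⊥-elim (¬p p)
  when-no x (no _)  ¬p = refl

  when-⇔ : ∀ x (P? : Dec P) (Q? : Dec Q) → (P → Q) → (Q → P) → x when P? ≡ x when Q?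
  when-⇔ x (yes p) Q? f g = sym (when-yes x Q? (f p))
  when-⇔ x (no ¬p) Q? f g = sym (when-no x Q? (¬p ∘ g))

  ∑-cong : ∀ {f g : A → Carrier} xs → (∀ {x} → x List∈.∈ xs → f x ≈ g x) → ∑ f xs ≈ ∑ g xs
  ∑-cong []       eq = ≈-refl
  ∑-cong (x ∷ xs) eq = ∙-cong (eq (here refl)) (∑-cong xs (eq ∘ there))

  ∑-zero : ∀ {f : A → Carrier} xs → (∀ {x} → x List∈.∈ xs → f x ≈ 𝟘) → ∑ f xs ≈ 𝟘
  ∑-zero []       eq = ≈-refl
  ∑-zero (x ∷ xs) eq = ≈-trans (∙-cong (eq (here refl)) (∑-zero xs (eq ∘ there))) (identityˡ 𝟘)

  ∑-filter : ∀ {P : A → Set} (P? : U.Decidable P) (f : A → Carrier) xs →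
             ∑ f (filter P? xs) ≈ ∑ (λ x → f x when P? x) xs
  ∑-filter P? f []       = ≈-refl
  ∑-filter P? f (x ∷ xs) with P? x
  ... | yes _ = ∙-congˡ (∑-filter P? f xs)
  ... | no  _ = ≈-trans (∑-filter P? f xs) (≈-sym (identityˡ _))

  ∑-∙ : ∀ (f g : A → Carrier) xs → ∑ (λ x → f x ∙ g x) xs ≈ ∑ f xs ∙ ∑ g xs
  ∑-∙ f g []       = ≈-sym (identityˡ 𝟘)
  ∑-∙ f g (x ∷ xs) = ≈-trans (∙-congˡ (∑-∙ f g xs)) (interchange _ _ _ _)

  ∑-swap : ∀ (f : A → B → Carrier) xs ys →
           ∑ (λ x → ∑ (f x) ys) xs ≈ ∑ (λ y → ∑ (λ x → f x y) xs) ys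
  ∑-swap f []       ys = ≈-sym (∑-zero ys λ _ → ≈-refl)
  ∑-swap f (x ∷ xs) ys = begin
    ∑ (f x) ys ∙ ∑ (λ x → ∑ (f x) ys) xs             ≈⟨ ∙-congˡ (∑-swap f xs ys) ⟩
    ∑ (f x) ys ∙ ∑ (λ y → ∑ (λ x → f x y) xs) ys     ≈⟨ ∑-∙ (f x) _ ys ⟨
    ∑ (λ y → f x y ∙ ∑ (λ x → f x y) xs) ys          ∎

  ∑-single : ∀ {f : A → Carrier} {xs x} → Unique xs → x List∈.∈ xs →
             (∀ {y} → y List∈.∈ xs → y ≢ x → f y ≈ 𝟘) → ∑ f xs ≈ f x
  ∑-single {f = f} {x ∷ xs} (x∉xs ∷ _) (here refl) eq =
    ≈-trans (∙-congˡ (∑-zero xs λ y∈xs → eq (there y∈xs) λ y≡x → All.lookup x∉xs y∈xs (sym y≡x)))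
            (identityʳ (f x))
  ∑-single (z∉xs ∷ uniq) (there x∈xs) eq =
    ≈-trans (∙-cong (eq (here refl) (All.lookup z∉xs x∈xs)) (∑-single uniq x∈xs (eq ∘ there)))
            (identityˡ _)

  ∑-mono : ∀ {f g : A → Carrier} xs → (∀ {x} → x List∈.∈ xs → f x ≼ g x) → ∑ f xs ≼ ∑ g xs
  ∑-mono []       le = ≼-reflexive ≈-refl
  ∑-mono (x ∷ xs) le = ∙-mono (le (here refl)) (∑-mono xs (le ∘ there))

  0≤∑ : ∀ {f : A → Carrier} xs → (∀ {x} → x List∈.∈ xs → 𝟘 ≼ f x) → 𝟘 ≼ ∑ f xs
  0≤∑ []       le = ≼-reflexive ≈-refl
  0≤∑ (x ∷ xs) le =
    ≼-trans (≼-reflexive (≈-sym (identityˡ 𝟘))) (∙-mono (le (here refl)) (0≤∑ xs (le ∘ there)))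

  term≤∑ : ∀ {f : A → Carrier} {xs x} → x List∈.∈ xs →
           (∀ {y} → y List∈.∈ xs → 𝟘 ≼ f y) → f x ≼ ∑ f xs
  term≤∑ {f = f} {x ∷ xs} (here refl) le =
    ≼-trans (≼-reflexive (≈-sym (identityʳ (f x)))) (∙-mono (≼-reflexive ≈-refl) (0≤∑ xs (le ∘ there)))
  term≤∑ (there x∈xs) le =
    ≼-trans (term≤∑ x∈xs (le ∘ there))
      (≼-trans (≼-reflexive (≈-sym (identityˡ _))) (∙-mono (le (here refl)) (≼-reflexive ≈-refl)))

-- Medians in a tree and its division into pieces with two ends

module Medians {m : ℕ} (T : Graph m) (isTree : IsTree T) where
  open Graph T
  open IsTree isTree

  data Walk : Fin m → Fin m → ℕ → Set where
    []  : ∀ {a} → Walk a a 0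
    _∷_ : ∀ {a b c l} → Adj a b → Walk b c l → Walk a c (suc l)

  Star⇒Walk : ∀ {a b} → Star Adj a b → ∃ (Walk a b)
  Star⇒Walk Star.ε       = 0 , []
  Star⇒Walk (e ◅ s) = let l , w = Star⇒Walk s in suc l , e ∷ w

  AdjAvoiding : Fin m → Fin m → Fin m → Set
  AdjAvoiding c a b = Adj a b × a ≢ c × b ≢ c

  SameSide : Fin m → Fin m → Fin m → Set
  SameSide c = Star (AdjAvoiding c)

  SameSide-sym : ∀ {c a b} → SameSide c a b → SameSide c b a
  SameSide-sym = Star.reverse λ (e , a≢c , b≢c) → adj-sym e , b≢c , a≢c

  -- Everything up to the last visit to `c` is dropped. What remains avoids `c` and is strictly
  -- shorter, which drives the descent to the median.
  afterLastVisit : ∀ c {a b l} → Walk a b l → b ≢ c →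
    (a ≢ c × SameSide c a b) ⊎ (∃[ d ] ∃[ l′ ] (Adj c d × Walk d b l′ × l′ < l × d ≢ c × SameSide c d b))
  afterLastVisit c []      b≢c = inj₁ (b≢c , Star.ε)
  afterLastVisit c {a} (_∷_ {b = d} e w) b≢c with afterLastVisit c w b≢c
  ... | inj₂ (d′ , l′ , e′ , w′ , l′<l , rest) = inj₂ (d′ , l′ , e′ , w′ , ℕₚ.m<n⇒m<1+n l′<l , rest)
  ... | inj₁ (d≢c , s) with a Fin.≟ c
  ...   | yes refl = inj₂ (d , _ , e , w , ℕₚ.≤-refl , d≢c , s)
  ...   | no  a≢c  = inj₁ (a≢c , (e , a≢c , d≢c) ◅ s)

  data Path : Fin m → Fin m → List (Fin m) → Set where
    [_] : ∀ a → Path a a (a ∷ [])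
    _∷_ : ∀ {a b c vs} → Adj a b → Path b c vs → Path a c (a ∷ vs)

  SimplePathAvoiding : Fin m → Fin m → Fin m → Set
  SimplePathAvoiding c a b = ∃[ vs ] (Path a b vs × Unique vs × All (c ≢_) vs)

  pathFrom : ∀ {c a d b vs} → Path d b vs → Unique vs → All (c ≢_) vs →
             a List∈.∈ vs → SimplePathAvoiding c a b
  pathFrom p@([ _ ])  uniq       avoids       (here refl) = _ , p , uniq , avoids
  pathFrom p@(_ ∷ _)  uniq       avoids       (here refl) = _ , p , uniq , avoids
  pathFrom (_ ∷ p)    (_ ∷ uniq) (_ ∷ avoids) (there a∈) = pathFrom p uniq avoids a∈

  -- Loop erasure: if `a` already occurs on the simple path from its successor, the path is
  -- restarted at that occurrence.
  simplePath : ∀ {c a b} → a ≢ c → SameSide c a b → SimplePathAvoiding c a b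
  simplePath {a = a} a≢c Star.ε = a ∷ [] , [ a ] , [] ∷ [] , (λ c≡a → a≢c (sym c≡a)) ∷ []
  simplePath {a = a} a≢c ((e , _ , d≢c) ◅ s) with simplePath d≢c s
  ... | vs , p , uniq , avoids with any? (a Fin.≟_) vs
  ...   | yes a∈ = pathFrom p uniq avoids a∈
  ...   | no  a∉ = a ∷ vs , e ∷ p , ¬Any⇒All¬ vs a∉ ∷ uniq , (λ c≡a → a≢c (sym c≡a)) ∷ avoids

  closeUp : ∀ {z a b c vs} → Adj z a → Path a b vs → Adj b c → Linked Adj (z ∷ vs ∷ʳ c)
  closeUp e [ _ ]         e′ = e ∷ e′ ∷ [-]
  closeUp e (e₁ ∷ p)      e′ = e ∷ closeUp e₁ p e′

  2≤length : ∀ {a b vs} → Path a b vs → a ≢ b → 2 ≤ length vs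
  2≤length [ _ ]             a≢b = ⊥-elim (a≢b refl)
  2≤length (_ ∷ [ _ ])       _   = s≤s (s≤s z≤n)
  2≤length (_ ∷ (_ ∷ _))     _   = s≤s (s≤s z≤n)

  -- Otherwise a simple path from `a` to `b` avoiding `c` closes up through `c` to a cycle.
  neighbours-separated : ∀ {c a b} → Adj c a → Adj c b → SameSide c a b → a ≡ b
  neighbours-separated {c} {a} {b} ca cb s with a Fin.≟ b
  ... | yes a≡b = a≡b
  ... | no  a≢b with simplePath (λ a≡c → adj-irrefl (sym a≡c) ca) s
  ...   | vs , p , uniq , avoids =
    ⊥-elim (acyclic c vs (avoids ∷ uniq , closeUp ca p (adj-sym cb) , 2≤length p a≢b))

  -- Vacuous when `c` is `x` or `y`, so that one of the three nodes may itself be their median.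
  Separates : Fin m → Fin m → Fin m → Set
  Separates c x y = x ≢ c → y ≢ c → ¬ SameSide c x y

  IsMedian : Fin m → Fin m → Fin m → Fin m → Set
  IsMedian c x y z = Separates c x y × Separates c x z × Separates c y z

  -- The neighbours of `c` that follow the last visits of the two walks to `c` lie on the same side,
  -- hence coincide; a single step therefore shortens both walks.
  approach : ∀ {c x y k l} → x ≢ c → y ≢ c → SameSide c x y → Walk c x k → Walk c y l →
             ∃[ d ] ∃[ k′ ] ∃[ l′ ] (Adj c d × Walk d x k′ × k′ < k × Walk d y l′ × l′ < l)
  approach {c} x≢c y≢c s u v with afterLastVisit c u x≢c | afterLastVisit c v y≢c
  ... | inj₁ (c≢c , _) | _              = ⊥-elim (c≢c refl)
  ... | inj₂ _         | inj₁ (c≢c , _) = ⊥-elim (c≢c refl)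
  ... | inj₂ (d , k′ , cd , u′ , k′<k , _ , s₁) | inj₂ (d′ , l′ , cd′ , v′ , l′<l , _ , s₂)
    with neighbours-separated cd cd′ (s₁ ◅◅ s ◅◅ SameSide-sym s₂)
  ... | refl = d , k′ , l′ , cd , u′ , k′<k , v′ , l′<l

  module _ (em : ExcludedMiddle 0ℓ) where

    separates? : ∀ c x y → Separates c x y ⊎ (x ≢ c × y ≢ c × SameSide c x y)
    separates? c x y with em {x ≢ c × y ≢ c × SameSide c x y}
    ... | yes s = inj₂ s
    ... | no ¬s = inj₁ λ x≢c y≢c s → ¬s (x≢c , y≢c , s)

    -- If x and y lie on the same side of c, then moving c towards both shortens two walks
    -- and lengthens the third by one only.
    median-search : ∀ {c x y z i j k n} → Walk c x i → Walk c y j → Walk c z k →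
                    i + j + k ≤ n → Acc _<_ n → ∃[ d ] IsMedian d x y z
    median-search {c} {x} {y} {z} {i} {j} {k} u v w le (acc rec)
      with separates? c x y | separates? c x z | separates? c y z
    ... | inj₁ xy | inj₁ xz | inj₁ yz = c , xy , xz , yz
    ... | inj₂ (x≢c , y≢c , s) | _ | _ with approach x≢c y≢c s u v
    ...   | d , i′ , j′ , e , u′ , i′<i , v′ , j′<j =
      median-search u′ v′ (adj-sym e ∷ w) ℕₚ.≤-refl (rec (ℕₚ.<-≤-trans lt le))
      where
      open ℕₚ.≤-Reasoning
      lt : i′ + j′ + suc k < i + j + k
      lt = begin
        suc (i′ + j′ + suc k)       ≡⟨ cong suc (ℕₚ.+-suc (i′ + j′) k) ⟩
        suc (suc (i′ + j′)) + k     ≡⟨ cong (_+ k) (cong suc (ℕₚ.+-suc i′ j′)) ⟨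
        suc i′ + suc j′ + k         ≤⟨ ℕₚ.+-monoˡ-≤ k (ℕₚ.+-mono-≤ i′<i j′<j) ⟩
        i + j + k                   ∎
    median-search {c} {x} {y} {z} {i} {j} {k} u v w le (acc rec)
        | inj₁ _ | inj₂ (x≢c , z≢c , s) | _ with approach x≢c z≢c s u w
    ...   | d , i′ , k′ , e , u′ , i′<i , w′ , k′<k =
      median-search u′ (adj-sym e ∷ v) w′ ℕₚ.≤-refl (rec (ℕₚ.<-≤-trans lt le))
      where
      open ℕₚ.≤-Reasoning
      lt : i′ + suc j + k′ < i + j + k
      lt = begin
        suc (i′ + suc j + k′)       ≡⟨ cong (λ l → suc (l + k′)) (ℕₚ.+-suc i′ j) ⟩
        suc (suc i′ + j + k′)       ≡⟨ ℕₚ.+-suc (suc i′ + j) k′ ⟨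
        suc i′ + j + suc k′         ≤⟨ ℕₚ.+-mono-≤ (ℕₚ.+-monoˡ-≤ j i′<i) k′<k ⟩
        i + j + k                   ∎
    median-search {c} {x} {y} {z} {i} {j} {k} u v w le (acc rec)
        | inj₁ _ | inj₁ _ | inj₂ (y≢c , z≢c , s) with approach y≢c z≢c s v w
    ...   | d , j′ , k′ , e , v′ , j′<j , w′ , k′<k =
      median-search (adj-sym e ∷ u) v′ w′ ℕₚ.≤-refl (rec (ℕₚ.<-≤-trans lt le))
      where
      open ℕₚ.≤-Reasoning
      lt : suc i + j′ + k′ < i + j + k
      lt = begin
        suc (suc i + j′ + k′)       ≡⟨ ℕₚ.+-suc (suc i + j′) k′ ⟨
        suc i + j′ + suc k′         ≡⟨ cong (_+ suc k′) (ℕₚ.+-suc i j′) ⟨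
        i + suc j′ + suc k′         ≤⟨ ℕₚ.+-mono-≤ (ℕₚ.+-monoʳ-≤ i j′<j) k′<k ⟩
        i + j + k                   ∎

    median : ∀ x y z → ∃[ c ] IsMedian c x y z
    median x y z = median-search [] (proj₂ (Star⇒Walk (connected x y)))
      (proj₂ (Star⇒Walk (connected x z))) ℕₚ.≤-refl (<-wellFounded _)

    choose : Fin m → Fin m → Fin m → Fin 3 → Fin m
    choose x y z zero             = x
    choose x y z (suc zero)       = y
    choose x y z (suc (suc zero)) = z

    fromCentre : ∀ {c x} → SameSide c c x → x ≡ c
    fromCentre Star.ε                   = refl
    fromCentre ((_ , c≢c , _) ◅ _) = ⊥-elim (c≢c refl)

    -- Around the median `c`, side 2 is the component of `z`, side 1 that of `y`, and side 0 is all
    -- the rest, including components that contain none of the three. Since the median separates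
    -- them, each of `x`, `y`, `z` other than `c` is the apex of its own side.
    three-sides : ∀ x y z → ∃[ c ] ∃[ side ]
      ((∀ {a b} → Adj a b → a ≢ c → b ≢ c → side a ≡ side b) ×
       (∀ a → a ≡ x ⊎ a ≡ y ⊎ a ≡ z → a ≢ c → choose x y z (side a) ≡ a))
    three-sides x y z with median x y z
    ... | c , xy , xz , yz = c , side , side-adj , side-apex
      where
      side′ : ∀ {P Q : Set} → Dec P → Dec Q → Fin 3
      side′ (yes _) _       = suc (suc zero)
      side′ (no _)  (yes _) = suc zero
      side′ (no _)  (no _)  = zero

      side′-cong : ∀ {P P′ Q Q′ : Set} (P? : Dec P) (P′? : Dec P′) (Q? : Dec Q) (Q′? : Dec Q′) →
                   (P → P′) → (P′ → P) → (Q → Q′) → (Q′ → Q) → side′ P? Q? ≡ side′ P′? Q′?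
      side′-cong (yes _) (yes _) _       _       _ _ _ _ = refl
      side′-cong (yes p) (no ¬p) _       _       f _ _ _ = ⊥-elim (¬p (f p))
      side′-cong (no ¬p) (yes p) _       _       _ f _ _ = ⊥-elim (¬p (f p))
      side′-cong (no _)  (no _)  (yes _) (yes _) _ _ _ _ = refl
      side′-cong (no _)  (no _)  (yes q) (no ¬q) _ _ f _ = ⊥-elim (¬q (f q))
      side′-cong (no _)  (no _)  (no ¬q) (yes q) _ _ _ f = ⊥-elim (¬q (f q))
      side′-cong (no _)  (no _)  (no _)  (no _)  _ _ _ _ = refl

      side : Fin m → Fin 3
      side a = side′ (em {SameSide c z a}) (em {SameSide c y a})

      side-adj : ∀ {a b} → Adj a b → a ≢ c → b ≢ c → side a ≡ side b
      side-adj e a≢c b≢c = side′-cong em em em em (_◅◅ forth) (_◅◅ back) (_◅◅ forth) (_◅◅ back)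
        where
        forth = (e , a≢c , b≢c) ◅ Star.ε
        back  = (adj-sym e , b≢c , a≢c) ◅ Star.ε

      apart : ∀ {u v} → Separates c u v → u ≢ c → ¬ SameSide c v u
      apart {u} {v} sep u≢c s with v Fin.≟ c
      ... | yes refl = u≢c (fromCentre s)
      ... | no  v≢c  = sep u≢c v≢c (SameSide-sym s)

      choose-side : ∀ {a} (P? : Dec (SameSide c z a)) (Q? : Dec (SameSide c y a)) →
                    a ≡ x ⊎ a ≡ y ⊎ a ≡ z → a ≢ c → choose x y z (side′ P? Q?) ≡ a
      choose-side (yes s) _       (inj₁ refl)        a≢c = ⊥-elim (apart xz a≢c s)
      choose-side (yes s) _       (inj₂ (inj₁ refl)) a≢c = ⊥-elim (apart yz a≢c s)
      choose-side (yes s) _       (inj₂ (inj₂ refl)) a≢c = refl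
      choose-side (no _)  (yes s) (inj₁ refl)        a≢c = ⊥-elim (apart xy a≢c s)
      choose-side (no _)  (yes s) (inj₂ (inj₁ refl)) a≢c = refl
      choose-side (no ¬s) _       (inj₂ (inj₂ refl)) a≢c = ⊥-elim (¬s Star.ε)
      choose-side (no _)  (no _)  (inj₁ refl)        a≢c = refl
      choose-side (no _)  (no ¬s) (inj₂ (inj₁ refl)) a≢c = ⊥-elim (¬s Star.ε)

      side-apex : ∀ a → a ≡ x ⊎ a ≡ y ⊎ a ≡ z → a ≢ c → choose x y z (side a) ≡ a
      side-apex a = choose-side em em

    -- An end need not lie in its piece: the median becomes an end of all three parts of a split but
    -- lies in at most one of them. Accordingly `separated` accepts either endpoint of a leaving
    -- edge as an end of the piece being left.
    record Partition {k} (mark : Fin k → Fin m) (M : ℕ) : Set where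
      field
        piece : Fin m → Fin M
        β₁ β₂ : Fin M → Fin m

      IsEnd : Fin M → Fin m → Set
      IsEnd p a = a ≡ β₁ p ⊎ a ≡ β₂ p

      field
        mark-isEnd : ∀ j → IsEnd (piece (mark j)) (mark j)
        separated  : ∀ {a b} → Adj a b → piece a ≢ piece b → IsEnd (piece a) a ⊎ IsEnd (piece a) b

    -- The piece containing the new mark z, with ends x and y, is split into three by the
    -- median of x, y and z.
    addMark : ∀ {k M} {mark : Fin (suc k) → Fin m} →
              Partition (λ j → mark (suc j)) M → Partition mark (2 + M)
    addMark {k} {M} {mark} P = result (three-sides x y z)
      where
      open Partition P
      z = mark zero
      p = piece z
      x = β₁ p
      y = β₂ p

      module _ (c : Fin m) (side : Fin m → Fin 3)
               (side-adj : ∀ {a b} → Adj a b → a ≢ c → b ≢ c → side a ≡ side b)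
               (side-apex : ∀ a → a ≡ x ⊎ a ≡ y ⊎ a ≡ z → a ≢ c → choose x y z (side a) ≡ a) where

        -- Side 0 inherits the index of `p`, shifted by two, and with it the end `x`; the new
        -- indices 1 and 0 go to the parts at `y` and at `z`.
        refine : ∀ q → Dec (q ≡ p) → Fin 3 → Fin (2 + M)
        refine q (yes _) zero             = suc (suc q)
        refine q (yes _) (suc zero)       = suc zero
        refine q (yes _) (suc (suc zero)) = zero
        refine q (no _)  _                = suc (suc q)

        piece′ : Fin m → Fin (2 + M)
        piece′ a = refine (piece a) (piece a Fin.≟ p) (side a)

        β₁′ β₂′ : Fin (2 + M) → Fin m
        β₁′ zero          = z
        β₁′ (suc zero)    = y
        β₁′ (suc (suc q)) = β₁ q
        β₂′ zero          = c
        β₂′ (suc zero)    = c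
        β₂′ (suc (suc q)) with q Fin.≟ p
        ... | yes _ = c
        ... | no  _ = β₂ q

        β₂′-p : β₂′ (suc (suc p)) ≡ c
        β₂′-p with p Fin.≟ p
        ... | yes _   = refl
        ... | no  p≢p = ⊥-elim (p≢p refl)

        β₂′-≢p : ∀ {q} → q ≢ p → β₂′ (suc (suc q)) ≡ β₂ q
        β₂′-≢p {q} q≢p with q Fin.≟ p
        ... | yes q≡p = ⊥-elim (q≢p q≡p)
        ... | no  _   = refl

        refine-≢p : ∀ {q} (d : Dec (q ≡ p)) s → q ≢ p → refine q d s ≡ suc (suc q)
        refine-≢p (yes q≡p) s q≢p = ⊥-elim (q≢p q≡p)
        refine-≢p (no _)    s q≢p = refl

        β₁′-refine : ∀ {q} (d : Dec (q ≡ p)) s → q ≡ p → β₁′ (refine q d s) ≡ choose x y z s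
        β₁′-refine (yes _)  zero             refl = refl
        β₁′-refine (yes _)  (suc zero)       refl = refl
        β₁′-refine (yes _)  (suc (suc zero)) refl = refl
        β₁′-refine (no p≢p) s                refl = ⊥-elim (p≢p refl)

        β₂′-refine : ∀ {q} (d : Dec (q ≡ p)) s → q ≡ p → β₂′ (refine q d s) ≡ c
        β₂′-refine (yes _)  zero             refl = β₂′-p
        β₂′-refine (yes _)  (suc zero)       refl = refl
        β₂′-refine (yes _)  (suc (suc zero)) refl = refl
        β₂′-refine (no p≢p) s                refl = ⊥-elim (p≢p refl)

        IsEnd′ : Fin (2 + M) → Fin m → Set
        IsEnd′ q a = a ≡ β₁′ q ⊎ a ≡ β₂′ q

        isEnd-outside : ∀ a {b} → piece a ≢ p → IsEnd (piece a) b → IsEnd′ (piece′ a) b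
        isEnd-outside a {b} a∉ end =
          subst (λ q → IsEnd′ q b) (sym (refine-≢p (piece a Fin.≟ p) (side a) a∉))
            ([ inj₁ , (λ eq → inj₂ (trans eq (sym (β₂′-≢p a∉)))) ]′ end)

        isEnd-inside : ∀ a {b} → piece a ≡ p → b ≡ c ⊎ choose x y z (side a) ≡ b → IsEnd′ (piece′ a) b
        isEnd-inside a a∈ (inj₁ b≡c) = inj₂ (trans b≡c (sym (β₂′-refine (piece a Fin.≟ p) (side a) a∈)))
        isEnd-inside a a∈ (inj₂ eq)  = inj₁ (trans (sym eq) (sym (β₁′-refine (piece a Fin.≟ p) (side a) a∈)))

        isApex : ∀ {a b} → piece a ≡ p → IsEnd (piece a) b → b ≡ x ⊎ b ≡ y ⊎ b ≡ z
        isApex a∈ (inj₁ eq) = inj₁ (trans eq (cong β₁ a∈))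
        isApex a∈ (inj₂ eq) = inj₂ (inj₁ (trans eq (cong β₂ a∈)))

        end-self : ∀ a → piece a ≡ p → a ≡ x ⊎ a ≡ y ⊎ a ≡ z → IsEnd′ (piece′ a) a
        end-self a a∈ apex with a Fin.≟ c
        ... | yes a≡c = isEnd-inside a a∈ (inj₁ a≡c)
        ... | no  a≢c = isEnd-inside a a∈ (inj₂ (side-apex a apex a≢c))

        mark-isEnd′ : ∀ j → IsEnd′ (piece′ (mark j)) (mark j)
        mark-isEnd′ zero = end-self z refl (inj₂ (inj₂ refl))
        mark-isEnd′ (suc j) with piece (mark (suc j)) Fin.≟ p in eq
        ... | yes a∈ = subst (λ d → IsEnd′ (refine _ d _) _) eq
                         (end-self (mark (suc j)) a∈ (isApex a∈ (mark-isEnd j)))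
        ... | no  a∉ = subst (λ d → IsEnd′ (refine _ d _) _) eq (isEnd-outside (mark (suc j)) a∉ (mark-isEnd j))

        separated′ : ∀ {a b} → Adj a b → piece′ a ≢ piece′ b → IsEnd′ (piece′ a) a ⊎ IsEnd′ (piece′ a) b
        separated′ {a} {b} e ≢′ = by-cases (piece a Fin.≟ p) (piece b Fin.≟ p) (a Fin.≟ c) (b Fin.≟ c)
          where
          by-cases : Dec (piece a ≡ p) → Dec (piece b ≡ p) → Dec (a ≡ c) → Dec (b ≡ c) →
                     IsEnd′ (piece′ a) a ⊎ IsEnd′ (piece′ a) b
          by-cases (no a∉) _ _ _ with separated e pa≢pb
            where
            pa≢pb : piece a ≢ piece b
            pa≢pb eq = ≢′ (trans (refine-≢p (piece a Fin.≟ p) (side a) a∉)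
              (trans (cong (λ q → suc (suc q)) eq)
                (sym (refine-≢p (piece b Fin.≟ p) (side b) (λ b∈ → a∉ (trans eq b∈))))))
          ... | inj₁ end = inj₁ (isEnd-outside a a∉ end)
          ... | inj₂ end = inj₂ (isEnd-outside a a∉ end)
          by-cases (yes a∈) _        (yes a≡c) _         = inj₁ (isEnd-inside a a∈ (inj₁ a≡c))
          by-cases (yes a∈) _        (no _)    (yes b≡c) = inj₂ (isEnd-inside a a∈ (inj₁ b≡c))
          by-cases (yes a∈) (yes b∈) (no a≢c)  (no b≢c)  = ⊥-elim (≢′ same)
            where
            refine-cong : ∀ {q q′} (d : Dec (q ≡ p)) (d′ : Dec (q′ ≡ p)) {s s′} → q ≡ p → q′ ≡ p → s ≡ s′ →
                          refine q d s ≡ refine q′ d′ s′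
            refine-cong (yes _) (yes _) {zero}           refl refl refl = refl
            refine-cong (yes _) (yes _) {suc zero}       refl refl refl = refl
            refine-cong (yes _) (yes _) {suc (suc zero)} refl refl refl = refl
            refine-cong (no ¬q) _       refl _    _ = ⊥-elim (¬q refl)
            refine-cong _       (no ¬q) _    refl _ = ⊥-elim (¬q refl)
            same : piece′ a ≡ piece′ b
            same = refine-cong (piece a Fin.≟ p) (piece b Fin.≟ p) a∈ b∈ (side-adj e a≢c b≢c)
          by-cases (yes a∈) (no b∉)  (no a≢c)  (no b≢c) with separated e (λ eq → b∉ (trans (sym eq) a∈))
          ... | inj₁ end = inj₁ (isEnd-inside a a∈ (inj₂ (side-apex a (isApex a∈ end) a≢c)))
          -- The end is `b`, which lies outside `p`. As `side` is defined on the whole tree and the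
          -- edge avoids `c`, the side of `a` still has `b` as its apex.
          ... | inj₂ end = inj₂ (isEnd-inside a a∈ (inj₂
            (trans (cong (choose x y z) (side-adj e a≢c b≢c)) (side-apex b (isApex a∈ end) b≢c))))

        partition′ : Partition mark (2 + M)
        partition′ = record
          { piece = piece′ ; β₁ = β₁′ ; β₂ = β₂′
          ; mark-isEnd = mark-isEnd′ ; separated = separated′ }

      result : (∃[ c ] ∃[ side ]
        ((∀ {a b} → Adj a b → a ≢ c → b ≢ c → side a ≡ side b) ×
         (∀ a → a ≡ x ⊎ a ≡ y ⊎ a ≡ z → a ≢ c → choose x y z (side a) ≡ a))) → Partition mark (2 + M)
      result (c , side , side-adj , side-apex) = partition′ c side side-adj side-apex

    partition : ∀ k (mark : Fin k → Fin m) → Partition mark (1 + k * 2)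
    partition zero mark = record
      -- The single initial piece is never left and holds no mark, so any node can stand for both of
      -- its ends.
      { piece = λ _ → zero ; β₁ = λ _ → root ; β₂ = λ _ → root
      ; mark-isEnd = λ () ; separated = λ _ 0≢0 → ⊥-elim (0≢0 refl) }
      where root = Fin.fromℕ< nonempty
    partition (suc k) mark = addMark (partition k (λ j → mark (suc j)))

-- Quotient graphs and their cuts

module _ {n : ℕ} (G : Graph n) where
  open Graph G

  ∈-edges⁺ : ∀ {u v} → u Fin.< v → Adj u v → (u , v) List∈.∈ edges
  ∈-edges⁺ {u} {v} u<v e = List∈ₚ.∈-filter⁺ _
    (List∈ₚ.∈-cartesianProduct⁺ (List∈ₚ.∈-allFin u) (List∈ₚ.∈-allFin v)) (u<v , e)

  ∈-edges⁻ : ∀ {u v} → (u , v) List∈.∈ edges → u Fin.< v × Adj u v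
  ∈-edges⁻ e∈ = proj₂ (List∈ₚ.∈-filter⁻ (λ (u , v) → (u Finₚ.<? v) ×-dec adj? u v)
    {xs = cartesianProduct (allFin n) (allFin n)} e∈)

  edges-unique : Unique edges
  edges-unique = Uniqueₚ.filter⁺ _ (Uniqueₚ.cartesianProduct⁺ (Uniqueₚ.allFin⁺ n) (Uniqueₚ.allFin⁺ n))

preimage : ∀ {n N} → (Fin n → Fin N) → Subset N → Subset n
preimage q B = tabulate (lookup B ∘ q)

lookup-preimage : ∀ {n N} (q : Fin n → Fin N) B v → lookup (preimage q B) v ≡ lookup B (q v)
lookup-preimage q B = Vecₚ.lookup∘tabulate (lookup B ∘ q)

Saturated : ∀ {n N} → (Fin n → Fin N) → Subset n → Set
Saturated q A = ∀ {u v} → q u ≡ q v → lookup A u ≡ lookup A v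

saturated-preimage : ∀ {n N} (q : Fin n → Fin N) A → Saturated q A → ∃[ B ] preimage q B ≡ A
saturated-preimage {N = N} q A sat = tabulate B , trans
  (Vecₚ.tabulate-cong λ v → trans (Vecₚ.lookup∘tabulate B (q v)) (B-q v (class? (q v))))
  (Vecₚ.tabulate∘lookup A)
  where
  class? : ∀ a → Dec (∃[ v ] q v ≡ a)
  class? a = Finₚ.any? λ v → q v Fin.≟ a

  B′ : ∀ {a} → Dec (∃[ v ] q v ≡ a) → Bool
  B′ (yes (v , _)) = lookup A v
  -- A point outside the image of `q` does not affect `preimage`, so either side would do.
  B′ (no _)        = false

  B : Fin N → Bool
  B a = B′ (class? a)

  B-q : ∀ v (d : Dec (∃[ u ] q u ≡ q v)) → B′ d ≡ lookup A v
  B-q v (yes (u , eq)) = sat eq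
  B-q v (no ∄u)        = ⊥-elim (∄u (v , refl))

module _ {n N : ℕ} (G : Graph n) (q : Fin n → Fin N) where
  open Graph G

  quotientGraph : Graph N
  quotientGraph = record
    { Adj  = QAdj
    ; adj? = λ a b → ¬? (a Fin.≟ b) ×-dec
        Finₚ.any? λ u → Finₚ.any? λ v → adj? u v ×-dec (q u Fin.≟ a ×-dec q v Fin.≟ b)
    ; adj-sym    = λ (a≢b , u , v , e , qu , qv) → a≢b ∘ sym , v , u , adj-sym e , qv , qu
    ; adj-irrefl = λ a≡b (a≢b , _) → a≢b a≡b
    }
    where
    QAdj : Rel (Fin N) 0ℓ
    QAdj a b = a ≢ b × ∃[ u ] ∃[ v ] (Adj u v × q u ≡ a × q v ≡ b)

  -- Both orientations are allowed: edges are listed with the smaller endpoint first, and `q` need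
  -- not preserve the order.
  Joins : Fin N × Fin N → Fin n × Fin n → Set
  Joins (a , b) (u , v) = (q u ≡ a × q v ≡ b) ⊎ (q u ≡ b × q v ≡ a)

  joins? : ∀ h e → Dec (Joins h e)
  joins? (a , b) (u , v) = (q u Fin.≟ a ×-dec q v Fin.≟ b) ⊎-dec (q u Fin.≟ b ×-dec q v Fin.≟ a)

  edge-over : ∀ {u v} → Adj u v → q u ≢ q v →
    ∃[ h ] (h List∈.∈ Graph.edges quotientGraph × Joins h (u , v))
  edge-over {u} {v} e qu≢qv with Finₚ.<-cmp (q u) (q v)
  ... | tri< lt _ _ = _ , ∈-edges⁺ quotientGraph lt (qu≢qv , u , v , e , refl , refl) , inj₁ (refl , refl)
  ... | tri≈ _ eq _ = ⊥-elim (qu≢qv eq)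
  ... | tri> _ _ gt = _ , ∈-edges⁺ quotientGraph gt (qu≢qv ∘ sym , v , u , adj-sym e , refl , refl) , inj₂ (refl , refl)

  edge-over-unique : ∀ {h h′ e} → h List∈.∈ Graph.edges quotientGraph → h′ List∈.∈ Graph.edges quotientGraph →
    Joins h e → Joins h′ e → h ≡ h′
  edge-over-unique h∈ h′∈ (inj₁ (refl , refl)) (inj₁ (refl , refl)) = refl
  edge-over-unique h∈ h′∈ (inj₂ (refl , refl)) (inj₂ (refl , refl)) = refl
  edge-over-unique h∈ h′∈ (inj₁ (refl , refl)) (inj₂ (refl , refl)) =
    ⊥-elim (Finₚ.<-asym (proj₁ (∈-edges⁻ quotientGraph h∈)) (proj₁ (∈-edges⁻ quotientGraph h′∈)))
  edge-over-unique h∈ h′∈ (inj₂ (refl , refl)) (inj₁ (refl , refl)) =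
    ⊥-elim (Finₚ.<-asym (proj₁ (∈-edges⁻ quotientGraph h∈)) (proj₁ (∈-edges⁻ quotientGraph h′∈)))

Crosses : ∀ {n} → Subset n → Fin n × Fin n → Set
Crosses A (u , v) = lookup A u ≢ lookup A v

crosses? : ∀ {n} (A : Subset n) → U.Decidable (Crosses A)
crosses? A (u , v) = ¬? (lookup A u ≟ᵇ lookup A v)

joins-crosses : ∀ {n N} (G : Graph n) (q : Fin n → Fin N) B h e → Joins G q h e →
  (Crosses B h → Crosses (preimage q B) e) × (Crosses (preimage q B) e → Crosses B h)
joins-crosses G q B h (u , v) (inj₁ (refl , refl))
  rewrite lookup-preimage q B u | lookup-preimage q B v = (λ c → c) , (λ c → c)
joins-crosses G q B h (u , v) (inj₂ (refl , refl))
  rewrite lookup-preimage q B u | lookup-preimage q B v = (_∘ sym) , (_∘ sym)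

module Cuts (O : TotallyPreorderedMonoid) where
  open TotallyPreorderedMonoid O
  open Sums O
  open SetoidReasoning setoid

  cutOf : ∀ {n} → Graph n → (Fin n × Fin n → Carrier) → Subset n → Carrier
  cutOf G w A = ∑ w (filter (crosses? A) (Graph.edges G))

  module _ {n N : ℕ} (G : Graph n) (w : Fin n × Fin n → Carrier) (q : Fin n → Fin N) where

    quotientWeight : Fin N × Fin N → Carrier
    quotientWeight h = ∑ (λ e → w e when joins? G q h e) (Graph.edges G)

    quotientWeight-sym : ∀ a b → quotientWeight (a , b) ≈ quotientWeight (b , a)
    quotientWeight-sym a b = ∑-cong (Graph.edges G) λ {e} _ →
      ≈-reflexive (when-⇔ (w e) (joins? G q (a , b) e) (joins? G q (b , a) e) swap swap)

    private
      H = quotientGraph G q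

    -- An edge crossing the preimage joins two different classes, hence lies over exactly one edge
    -- of the quotient, and that one crosses `B`. Any other edge lies over no crossing edge. This is
    -- the double count behind `quotient-cut`.
    weight-once : ∀ B e → e List∈.∈ Graph.edges G →
      ∑ (λ h → w e when joins? G q h e) (filter (crosses? B) (Graph.edges H)) ≈
      w e when crosses? (preimage q B) e
    weight-once B e@(u , v) e∈ = by-cases (crosses? (preimage q B) e)
      where
      δH = filter (crosses? B) (Graph.edges H)

      ∈δH⁻ : ∀ {h} → h List∈.∈ δH → h List∈.∈ Graph.edges H × Crosses B h
      ∈δH⁻ = List∈ₚ.∈-filter⁻ (crosses? B) {xs = Graph.edges H}

      by-cases : (c : Dec (Crosses (preimage q B) e)) → ∑ (λ h → w e when joins? G q h e) δH ≈ w e when c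
      by-cases (no ¬c) = ∑-zero δH λ {h} h∈ → ≈-reflexive (when-no (w e) (joins? G q h e)
        λ j → ¬c (proj₁ (joins-crosses G q B h e j) (proj₂ (∈δH⁻ h∈))))
      by-cases (yes c) = over (edge-over G q (proj₂ (∈-edges⁻ G e∈)) qu≢qv)
        where
        qu≢qv : q u ≢ q v
        qu≢qv eq = c (trans (lookup-preimage q B u) (trans (cong (lookup B) eq) (sym (lookup-preimage q B v))))

        over : (∃[ h ] (h List∈.∈ Graph.edges H × Joins G q h e)) →
               ∑ (λ h → w e when joins? G q h e) δH ≈ w e
        over (h , h∈ , j) = ≈-trans
          (∑-single (Uniqueₚ.filter⁺ (crosses? B) (edges-unique H))
            (List∈ₚ.∈-filter⁺ (crosses? B) h∈ (proj₂ (joins-crosses G q B h e j) c))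
            λ {h′} h′∈ h′≢h → ≈-reflexive (when-no (w e) (joins? G q h′ e)
              λ j′ → h′≢h (edge-over-unique G q (proj₁ (∈δH⁻ h′∈)) h∈ j′ j)))
          (≈-reflexive (when-yes (w e) (joins? G q h e) j))

    quotient-cut : ∀ B → cutOf H quotientWeight B ≈ cutOf G w (preimage q B)
    quotient-cut B = begin
      ∑ (λ h → ∑ (λ e → w e when joins? G q h e) EG) δH      ≈⟨ ∑-swap _ δH EG ⟩
      ∑ (λ e → ∑ (λ h → w e when joins? G q h e) δH) EG      ≈⟨ ∑-cong EG (λ {e} → weight-once B e) ⟩
      ∑ (λ e → w e when crosses? (preimage q B) e) EG        ≈⟨ ∑-filter (crosses? (preimage q B)) w EG ⟨
      ∑ w (filter (crosses? (preimage q B)) EG)              ∎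
      where
      EG = Graph.edges G
      δH = filter (crosses? B) (Graph.edges H)

    -- Makes the new capacities strictly positive: they dominate a strictly positive summand because
    -- the others are nonnegative.
    weight≤quotientWeight : (∀ {e} → e List∈.∈ Graph.edges G → 𝟘 ≼ w e) →
      ∀ {a b} → Graph.Adj H a b → ∃[ e ] (e List∈.∈ Graph.edges G × w e ≼ quotientWeight (a , b))
    weight≤quotientWeight w-nonneg {a} {b} (a≢b , u , v , uv , qu , qv) = over (edge (Finₚ.<-cmp u v))
      where
      edge : Tri (u Fin.< v) (u ≡ v) (v Fin.< u) →
             ∃[ e ] (e List∈.∈ Graph.edges G × Joins G q (a , b) e)
      edge (tri< lt _ _) = _ , ∈-edges⁺ G lt uv , inj₁ (qu , qv)
      edge (tri≈ _ eq _) = ⊥-elim (a≢b (trans (sym qu) (trans (cong q eq) qv)))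
      edge (tri> _ _ gt) = _ , ∈-edges⁺ G gt (Graph.adj-sym G uv) , inj₂ (qv , qu)

      when-nonneg : ∀ {x} {P : Set} (P? : Dec P) → 𝟘 ≼ x → 𝟘 ≼ (x when P?)
      when-nonneg (yes _) 0≤x = 0≤x
      when-nonneg (no _)  _   = ≼-reflexive ≈-refl

      over : (∃[ e ] (e List∈.∈ Graph.edges G × Joins G q (a , b) e)) →
             ∃[ e ] (e List∈.∈ Graph.edges G × w e ≼ quotientWeight (a , b))
      over (e , e∈ , j) = e , e∈ ,
        subst (_≼ quotientWeight (a , b)) (when-yes (w e) (joins? G q (a , b) e) j)
          (term≤∑ e∈
            λ {e′} e′∈ → when-nonneg (joins? G q (a , b) e′) (w-nonneg e′∈))

-- Mimicking networks as quotients

ℝ-totallyPreorderedMonoid : ExcludedMiddle 0ℓ → TotallyPreorderedMonoid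
ℝ-totallyPreorderedMonoid em = record
  { commutativeMonoid = ℝ-+-commutativeMonoid
  ; _≼_               = _≤ᴿ_
  ; isTotalPreorder   = ≤ᴿ-isTotalPreorder em
  ; ∙-mono            = λ {x} {y} {u} {v} → +ᴿ-mono-≤ᴿ {x} {y} {u} {v}
  }

module _ (em : ExcludedMiddle 0ℓ) where

  open Cuts (ℝ-totallyPreorderedMonoid em)

  IsMinCut : ∀ {k n} → Network n → (Fin k ↣ Fin n) → Subset k → Subset n → Set
  IsMinCut G τ U A = Extends τ U A × (∀ A′ → Extends τ U A′ → Network.cut G A ≤ᴿ Network.cut G A′)

  cap-nonneg : ∀ {n} (G : Network n) {e} → e List∈.∈ Network.edges G → 0ᴿ ≤ᴿ uncurry (Network.cap G) e
  cap-nonneg G {u , v} e∈ =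
    <ᴿ⇒≤ᴿ {0ᴿ} {Network.cap G u v} (Network.cap-pos G u v (proj₂ (∈-edges⁻ (Network.graph G) e∈)))

  quotient : ∀ {n N} → Network n → (Fin n → Fin N) → Network N
  quotient {n} {N} G q = record
    { graph   = quotientGraph (Network.graph G) q
    ; cap     = λ a b → w (a , b)
    ; cap-sym = λ a b _ → quotientWeight-sym (Network.graph G) (uncurry (Network.cap G)) q a b
    ; cap-pos = λ a b ab → pos a b
        (weight≤quotientWeight (Network.graph G) (uncurry (Network.cap G)) q (cap-nonneg G) ab)
    }
    where
    w = quotientWeight (Network.graph G) (uncurry (Network.cap G)) q
    pos : ∀ a b → ∃[ e ] (e List∈.∈ Network.edges G × uncurry (Network.cap G) e ≤ᴿ w (a , b)) →
          0ᴿ <ᴿ w (a , b)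
    pos a b ((u , v) , e∈ , le) = <ᴿ-≤ᴿ-trans {0ᴿ} {Network.cap G u v} {w (a , b)}
      (Network.cap-pos G u v (proj₂ (∈-edges⁻ (Network.graph G) e∈))) le

  module _ {k n N : ℕ} (G : Network n) (τ : Fin k ↣ Fin n) (q : Fin n → Fin N)
           (minCut : ∀ U → ∃[ A ] (IsMinCut G τ U A × Saturated q A)) where
    open Injection τ using (to; injective)

    private
      H = quotient G q

    -- A cut that realises the terminal set `⁅ i ⁆` and is a union of classes separates the class of
    -- terminal `i` from all other terminals.
    quotient-injective : ∀ {i j} → q (to i) ≡ q (to j) → i ≡ j
    quotient-injective {i} {j} eq = from-cut (minCut ⁅ i ⁆)
      where
      from-cut : (∃[ A ] (IsMinCut G τ ⁅ i ⁆ A × Saturated q A)) → i ≡ j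
      from-cut (A , (ext , _) , sat) = sym (x∈⁅y⁆⇒x≡y i (Equivalence.to (ext j)
        (Vecₚ.lookup⇒[]= (to j) A (trans (sym (sat eq))
          (Vecₚ.[]=⇒lookup (Equivalence.from (ext i) (x∈⁅x⁆ i)))))))

    quotientTerminals : Fin k ↣ Fin N
    quotientTerminals = mk↣ quotient-injective

    extends-preimage : ∀ {U B} → Extends quotientTerminals U B → Extends τ U (preimage q B)
    extends-preimage {U} {B} ext i = mk⇔
      (λ i∈ → Equivalence.to (ext i) (Vecₚ.lookup⇒[]= _ B
        (trans (sym (lookup-preimage q B (to i))) (Vecₚ.[]=⇒lookup i∈))))
      (λ i∈ → Vecₚ.lookup⇒[]= _ _ (trans (lookup-preimage q B (to i))
        (Vecₚ.[]=⇒lookup (Equivalence.from (ext i) i∈))))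

    extends-image : ∀ {U B} → Extends τ U (preimage q B) → Extends quotientTerminals U B
    extends-image {U} {B} ext i = mk⇔
      (λ i∈ → Equivalence.to (ext i) (Vecₚ.lookup⇒[]= _ _
        (trans (lookup-preimage q B (to i)) (Vecₚ.[]=⇒lookup i∈))))
      (λ i∈ → Vecₚ.lookup⇒[]= _ B (trans (sym (lookup-preimage q B (to i)))
        (Vecₚ.[]=⇒lookup (Equivalence.from (ext i) i∈))))

    -- Each cut of the quotient lifts to a cut of `G` of equal cost, so contraction cannot lower a
    -- minimum; the saturated minimum cut descends, so it does not raise one either.
    quotient-isMimicking : IsMimicking G τ H quotientTerminals
    quotient-isMimicking U = from-cut (minCut U)
      where
      cut-eq : ∀ B → Network.cut H B ≃ Network.cut G (preimage q B)
      cut-eq = quotient-cut (Network.graph G) (uncurry (Network.cap G)) q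

      IsMimicked : Set
      IsMimicked = ∃[ m ] (IsTerminalCut G τ U m × IsTerminalCut H quotientTerminals U m)

      from-preimage : ∀ B → IsMinCut G τ U (preimage q B) → IsMimicked
      from-preimage B (ext , min) = Network.cut G (preimage q B)
        , record { attained = preimage q B , ext , IsEquivalence.refl ≃-isEquivalence {Network.cut G (preimage q B)}
                 ; minimal = min }
        , record { attained = B , extends-image ext , cut-eq B
                 ; minimal = λ B′ ext′ → ≤ᴿ-trans
                     {Network.cut G (preimage q B)} {Network.cut G (preimage q B′)} {Network.cut H B′}
                     (min (preimage q B′) (extends-preimage ext′))
                     (≃⇒≤ᴿ {Network.cut G (preimage q B′)} {Network.cut H B′}
                       (≃-sym {Network.cut H B′} {Network.cut G (preimage q B′)} (cut-eq B′))) }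

      from-cut : (∃[ A ] (IsMinCut G τ U A × Saturated q A)) → IsMimicked
      from-cut (A , min , sat) = from-eq (saturated-preimage q A sat)
        where
        from-eq : (∃[ B ] preimage q B ≡ A) → IsMimicked
        from-eq (B , eq) = from-preimage B (subst (IsMinCut G τ U) (sym eq) min)

-- Replacing a cut piece by piece

bit : Bool → Fin 2
bit false = zero
bit true  = suc zero

bit-injective : ∀ {a b} → bit a ≡ bit b → a ≡ b
bit-injective {false} {false} _ = refl
bit-injective {true}  {true}  _ = refl

funToFin-injective : ∀ {m n} {f g : Fin m → Fin n} → funToFin f ≡ funToFin g → ∀ i → f i ≡ g i
funToFin-injective {f = f} {g} eq i =
  trans (sym (Finₚ.finToFun-funToFin f i)) (trans (cong (λ z → finToFun z i) eq) (Finₚ.finToFun-funToFin g i))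

module Pieces (O : TotallyPreorderedMonoid) where
  open TotallyPreorderedMonoid O
  open Sums O
  open Cuts O
  open SetoidReasoning setoid

  Minimiser : ∀ {n} → (Subset n → Set) → (Subset n → Carrier) → Set
  Minimiser P f = ∃[ A ] (P A × ∀ A′ → P A′ → f A ≼ f A′)

  -- Infeasibility is a possible outcome because a trace may belong to no cut, for instance when
  -- `boundary p` lists a vertex twice and the two bits differ.
  minimiser? : ∀ {n} (P : Subset n → Set) → (∀ A → Dec (P A)) → (f : Subset n → Carrier) →
               Minimiser P f ⊎ (∀ A → ¬ P A)
  minimiser? {zero} P P? f with P? []
  ... | yes p = inj₁ ([] , p , λ { [] _ → ≼-reflexive ≈-refl })
  ... | no ¬p = inj₂ λ { [] → ¬p }
  minimiser? {suc n} P P? f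
    with minimiser? (P ∘ (true ∷_)) (P? ∘ (true ∷_)) (f ∘ (true ∷_))
       | minimiser? (P ∘ (false ∷_)) (P? ∘ (false ∷_)) (f ∘ (false ∷_))
  ... | inj₂ ¬t | inj₂ ¬f = inj₂ λ { (true ∷ A) → ¬t A ; (false ∷ A) → ¬f A }
  ... | inj₁ (A , p , min) | inj₂ ¬f = inj₁ (true ∷ A , p ,
    λ { (true ∷ A′) → min A′ ; (false ∷ A′) p′ → ⊥-elim (¬f A′ p′) })
  ... | inj₂ ¬t | inj₁ (A , p , min) = inj₁ (false ∷ A , p ,
    λ { (false ∷ A′) → min A′ ; (true ∷ A′) p′ → ⊥-elim (¬t A′ p′) })
  ... | inj₁ (A , p , min) | inj₁ (B , p′ , min′) with total (f (true ∷ A)) (f (false ∷ B))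
  ...   | inj₁ le = inj₁ (true ∷ A , p ,
    λ { (true ∷ A′) → min A′ ; (false ∷ A′) r → ≼-trans le (min′ A′ r) })
  ...   | inj₂ ge = inj₁ (false ∷ B , p′ ,
    λ { (false ∷ A′) → min′ A′ ; (true ∷ A′) r → ≼-trans ge (min A′ r) })

  module _ {n N b : ℕ} (G : Graph n) (w : Fin n × Fin n → Carrier)
           (pieceOf : Fin n → Fin N) (edgePiece : Fin n × Fin n → Fin N)
           (boundary : Fin N → Fin b → Fin n) where
    private
      EG = Graph.edges G

    -- Every edge is charged to one piece, even if its endpoints belong to others, so that the costs
    -- of the pieces add up to the cut.
    pieceCost : Fin N → Subset n → Carrier
    pieceCost p A = ∑ (λ e → (w e when crosses? A e) when (edgePiece e Fin.≟ p)) EG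

    cut≈∑pieceCost : ∀ A → cutOf G w A ≈ ∑ (λ p → pieceCost p A) (allFin N)
    cut≈∑pieceCost A = begin
      ∑ w (filter (crosses? A) EG)
        ≈⟨ ∑-filter (crosses? A) w EG ⟩
      ∑ (λ e → w e when crosses? A e) EG
        ≈⟨ ∑-cong EG (λ {e} _ → only-own e) ⟨
      ∑ (λ e → ∑ (λ p → (w e when crosses? A e) when (edgePiece e Fin.≟ p)) (allFin N)) EG
        ≈⟨ ∑-swap _ EG (allFin N) ⟩
      ∑ (λ p → pieceCost p A) (allFin N)
        ∎
      where
      only-own : ∀ e → ∑ (λ p → (w e when crosses? A e) when (edgePiece e Fin.≟ p)) (allFin N) ≈
                 w e when crosses? A e
      only-own e = ≈-trans
        (∑-single (Uniqueₚ.allFin⁺ N) (List∈ₚ.∈-allFin (edgePiece e))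
          λ {p} _ p≢ → ≈-reflexive (when-no _ (edgePiece e Fin.≟ p) (p≢ ∘ sym)))
        (≈-reflexive (when-yes _ (edgePiece e Fin.≟ edgePiece e) refl))

    trace : Fin N → Subset n → Fin (2 ^ b)
    trace p A = funToFin λ i → bit (lookup A (boundary p i))

    OnBoundary : Fin N → Fin n → Set
    OnBoundary p v = ∃[ i ] boundary p i ≡ v

    trace-agree : ∀ {p} A B {v} → trace p A ≡ trace p B → OnBoundary p v → lookup A v ≡ lookup B v
    trace-agree A B eq (i , refl) = bit-injective (funToFin-injective eq i)

    private
      from-minimiser : ∀ {P f} → Minimiser P f ⊎ (∀ A → ¬ P A) → Subset n
      from-minimiser (inj₁ (A , _)) = A
      -- A value for traces of no cut: `key` runs over all traces, while `canonical` asks only for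
      -- those that occur.
      from-minimiser (inj₂ _)       = tabulate λ _ → false

      from-minimiser-correct : ∀ {P f} (m : Minimiser P f ⊎ (∀ A → ¬ P A)) → ∀ A → P A →
        P (from-minimiser m) × f (from-minimiser m) ≼ f A
      from-minimiser-correct (inj₁ (_ , p , min)) A pA = p , min A pA
      from-minimiser-correct (inj₂ ¬P)            A pA = ⊥-elim (¬P A pA)

      minimiser : ∀ p z → Minimiser (λ A → trace p A ≡ z) (pieceCost p) ⊎ (∀ A → ¬ trace p A ≡ z)
      minimiser p z = minimiser? (λ A → trace p A ≡ z) (λ A → trace p A Fin.≟ z) (pieceCost p)

    optimum : Fin N → Fin (2 ^ b) → Subset n
    optimum p z = from-minimiser (minimiser p z)

    optimum-trace : ∀ p A → trace p (optimum p (trace p A)) ≡ trace p A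
    optimum-trace p A = proj₁ (from-minimiser-correct (minimiser p (trace p A)) A refl)

    optimum-least : ∀ p A → pieceCost p (optimum p (trace p A)) ≼ pieceCost p A
    optimum-least p A = proj₂ (from-minimiser-correct (minimiser p (trace p A)) A refl)

    -- The sides of `v` under the optima for all traces of its piece at once. These optima refer to
    -- no particular cut, so one map saturates every `canonical A`.
    key : Fin n → Fin (N * 2 ^ (2 ^ b))
    key v = combine (pieceOf v) (funToFin λ z → bit (lookup (optimum (pieceOf v) z) v))

    canonical : Subset n → Subset n
    canonical A = tabulate λ v → lookup (optimum (pieceOf v) (trace (pieceOf v) A)) v

    lookup-canonical : ∀ A v → lookup (canonical A) v ≡ lookup (optimum (pieceOf v) (trace (pieceOf v) A)) v
    lookup-canonical A = Vecₚ.lookup∘tabulate _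

    -- The optimum is chosen among cuts of the same trace as `A`. This both fixes the terminals and
    -- lets the choices of different pieces fit together.
    canonical-boundary : ∀ A {v} → OnBoundary (pieceOf v) v → lookup (canonical A) v ≡ lookup A v
    canonical-boundary A {v} v∈ =
      trans (lookup-canonical A v) (trace-agree (optimum (pieceOf v) (trace (pieceOf v) A)) A (optimum-trace (pieceOf v) A) v∈)

    canonical-saturated : ∀ A → Saturated key (canonical A)
    canonical-saturated A {u} {v} eq = trans (lookup-canonical A u)
      (trans (same (Finₚ.combine-injective (pieceOf u) _ (pieceOf v) _ eq)) (sym (lookup-canonical A v)))
      where
      same : pieceOf u ≡ pieceOf v × _ → lookup (optimum (pieceOf u) (trace (pieceOf u) A)) u ≡
                                         lookup (optimum (pieceOf v) (trace (pieceOf v) A)) v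
      same (pu≡pv , bits) = trans (bit-injective (funToFin-injective bits (trace (pieceOf u) A)))
        (cong (λ p → lookup (optimum (pieceOf v) (trace p A)) v) pu≡pv)

    -- The two ways in which the optimum of `p` determines the side of `v` in the canonical cut: `v`
    -- takes its side from `p`, or both `p` and its own piece leave it on the side it has in `A`.
    InPiece : Fin N → Fin n → Set
    InPiece p v = pieceOf v ≡ p ⊎ (OnBoundary p v × OnBoundary (pieceOf v) v)

    canonical-inPiece : ∀ A p {v} → InPiece p v → lookup (canonical A) v ≡ lookup (optimum p (trace p A)) v
    canonical-inPiece A p {v} (inj₁ refl)       = lookup-canonical A v
    canonical-inPiece A p {v} (inj₂ (v∈ , v∈′)) =
      trans (canonical-boundary A v∈′) (sym (trace-agree (optimum p (trace p A)) A (optimum-trace p A) v∈))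

    -- On the edges charged to `p` the canonical cut coincides with the optimum of `p` for the trace
    -- of `A`, so no piece becomes more expensive.
    canonical-cut : (∀ {u v} → (u , v) List∈.∈ EG → InPiece (edgePiece (u , v)) u × InPiece (edgePiece (u , v)) v) →
                    ∀ A → cutOf G w (canonical A) ≼ cutOf G w A
    canonical-cut inPiece A =
      ≼-trans (≼-reflexive (cut≈∑pieceCost (canonical A)))
        (≼-trans (∑-mono (allFin N) λ {p} _ → improves p)
          (≼-reflexive (≈-sym (cut≈∑pieceCost A))))
      where
      same-cost : ∀ p e → e List∈.∈ EG →
        (w e when crosses? (canonical A) e) when (edgePiece e Fin.≟ p) ≡
        (w e when crosses? (optimum p (trace p A)) e) when (edgePiece e Fin.≟ p)
      same-cost p e@(u , v) e∈ = by-cases (edgePiece e Fin.≟ p)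
        where
        by-cases : (d : Dec (edgePiece e ≡ p)) →
          (w e when crosses? (canonical A) e) when d ≡ (w e when crosses? (optimum p (trace p A)) e) when d
        by-cases (no _)     = refl
        by-cases (yes refl) = when-⇔ (w e) (crosses? (canonical A) e) (crosses? (optimum p (trace p A)) e)
          (λ c eq → c (trans u≡ (trans eq (sym v≡)))) (λ c eq → c (trans (sym u≡) (trans eq v≡)))
          where
          u≡ = canonical-inPiece A p (proj₁ (inPiece e∈))
          v≡ = canonical-inPiece A p (proj₂ (inPiece e∈))

      improves : ∀ p → pieceCost p (canonical A) ≼ pieceCost p A
      improves p = ≼-trans (≼-reflexive (∑-cong EG λ {e} e∈ → ≈-reflexive (same-cost p e e∈)))
        (optimum-least p A)

-- Growth of central binomial coefficients

C-symmetric : ∀ i j → (i + j) C i ≡ (i + j) C j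
C-symmetric i j = trans (nCk≡nC[n∸k] (ℕₚ.m≤m+n i j)) (cong ((i + j) C_) (ℕₚ.m+n∸m≡n i j))

central : ℕ → ℕ
central n = n C (n / 2)

2+-/2 : ∀ n → (2 + n) / 2 ≡ 1 + n / 2
2+-/2 n = m/n≡1+[m∸n]/n {2 + n} {2} (s≤s (s≤s z≤n))

1+2*-/2 : ∀ j → (1 + j * 2) / 2 ≡ j
1+2*-/2 zero    = refl
1+2*-/2 (suc j) = trans (2+-/2 (1 + j * 2)) (cong suc (1+2*-/2 j))

even⊎odd : ∀ n → ∃[ j ] (n ≡ j * 2 ⊎ n ≡ 1 + j * 2)
even⊎odd zero = 0 , inj₁ refl
even⊎odd (suc n) with even⊎odd n
... | j , inj₁ refl = j , inj₂ refl
... | j , inj₂ refl = suc j , inj₁ refl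

module _ (j : ℕ) where
  private
    d = j * 2
    pascal = nCk+nC[k+1]≡[n+1]C[k+1]

    d≡ : d ≡ j + j
    d≡ = trans (ℕₚ.*-comm j 2) (cong (j +_) (ℕₚ.+-identityʳ j))

  odd-symmetric : (1 + d) C j ≡ (1 + d) C (1 + j)
  odd-symmetric = sym (subst (λ n → (1 + n) C (1 + j) ≡ (1 + n) C j) (sym d≡) (C-symmetric (1 + j) j))

  -- For d = 2j the Pascal rule gives C(d + 2, j + 1) = 2 (a + b) and C(d + 2, j + 2) ≥ a + 2 b,
  -- where a = C(d, j) and b = C(d, j + 1).
  C-even≤ : (2 + d) C (1 + j) ≤ 2 * ((2 + d) C (2 + j))
  C-even≤ = subst₂ (λ l r → l ≤ 2 * r) (sym lhs) (sym rhs)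
    (subst₂ _≤_ (sym (lhs′ a b)) (sym (rhs′ a b c)) (ℕₚ.m≤m+n (2 * a + 2 * b) _))
    where
    a = d C j
    b = d C (1 + j)
    c = d C (2 + j)
    lhs : (2 + d) C (1 + j) ≡ (a + b) + (a + b)
    lhs = trans (sym (pascal (1 + d) j)) (cong₂ _+_ (trans odd-symmetric (sym (pascal d j))) (sym (pascal d j)))
    rhs : (2 + d) C (2 + j) ≡ (a + b) + (b + c)
    rhs = trans (sym (pascal (1 + d) (1 + j))) (cong₂ _+_ (sym (pascal d j)) (sym (pascal d (1 + j))))
    lhs′ : ∀ a b → (a + b) + (a + b) ≡ 2 * a + 2 * b
    lhs′ = solve-∀
    rhs′ : ∀ a b c → 2 * ((a + b) + (b + c)) ≡ (2 * a + 2 * b) + (2 * b + 2 * c)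
    rhs′ = solve-∀

  -- Row `1 + d` has two equal central entries `x`. Expanding three rows down by Pascal's rule gives
  -- 5x + y + z.
  C-odd-step : 4 * ((1 + d) C j) ≤ (4 + d) C (2 + j)
  C-odd-step = subst (4 * x ≤_) (sym eq) (subst (4 * x ≤_) (sym (rearrange x y z w)) (ℕₚ.m≤m+n (4 * x) _))
    where
    x = (1 + d) C j
    y = (1 + d) C (2 + j)
    z = (2 + d) C j
    w = (2 + d) C (1 + j)
    2+d : (2 + d) C (1 + j) ≡ x + x
    2+d = trans (sym (pascal (1 + d) j)) (cong (x +_) (sym odd-symmetric))
    2+d′ : (2 + d) C (2 + j) ≡ x + y
    2+d′ = trans (sym (pascal (1 + d) (1 + j))) (cong (_+ y) (sym odd-symmetric))
    rearrange : ∀ x y z w → ((z + (x + x)) + ((x + x) + (x + y))) ≡ 4 * x + (x + y + z)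
    rearrange = solve-∀
    eq : (4 + d) C (2 + j) ≡ (z + (x + x)) + ((x + x) + (x + y))
    eq = trans (sym (pascal (3 + d) (1 + j))) (cong₂ _+_
      (trans (sym (pascal (2 + d) j)) (cong (z +_) 2+d))
      (trans (sym (pascal (2 + d) (1 + j))) (cong₂ _+_ 2+d 2+d′)))

-- Here Pascal's rule yields 3a + 3b + z, with only three copies of the central entry `a`; the
-- fourth comes from a ≤ 2b, which is `C-even≤`.
C-even-step : ∀ j → 4 * ((2 + j * 2) C (1 + j)) ≤ (5 + j * 2) C (2 + j)
C-even-step j = ℕₚ.≤-trans
  (ℕₚ.≤-trans (subst (_≤ 3 * a + 2 * b) (4*a a) (ℕₚ.+-monoʳ-≤ (3 * a) (C-even≤ j))) (ℕₚ.m≤m+n _ (b + z)))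
  (ℕₚ.≤-reflexive (trans (rearrange a b z) (sym eq)))
  where
  e = 2 + j * 2
  a = e C (1 + j)
  b = e C (2 + j)
  z = (1 + e) C j
  pascal = nCk+nC[k+1]≡[n+1]C[k+1]
  e≡ : e ≡ j + (2 + j)
  e≡ = trans (cong (2 +_) (ℕₚ.*-comm j 2)) (lemma j)
    where
    lemma : ∀ j → 2 + 2 * j ≡ j + (2 + j)
    lemma = solve-∀
  even-symmetric : e C j ≡ b
  even-symmetric = subst (λ n → n C j ≡ n C (2 + j)) (sym e≡) (C-symmetric j (2 + j))
  1+e : (1 + e) C (1 + j) ≡ b + a
  1+e = trans (sym (pascal e j)) (cong (_+ a) even-symmetric)
  eq : (3 + e) C (2 + j) ≡ (z + (b + a)) + ((b + a) + (a + b))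
  eq = trans (sym (pascal (2 + e) (1 + j))) (cong₂ _+_
    (trans (sym (pascal (1 + e) j)) (cong (z +_) 1+e))
    (trans (sym (pascal (1 + e) (1 + j))) (cong₂ _+_ 1+e (sym (pascal e (1 + j))))))
  4*a : ∀ a → 3 * a + a ≡ 4 * a
  4*a = solve-∀
  rearrange : ∀ a b z → (3 * a + 2 * b) + (b + z) ≡ (z + (b + a)) + ((b + a) + (a + b))
  rearrange = solve-∀

-- Three more rows gain the factor 4 that one more vertex per bag costs. At `n = 0` this fails, as
-- `central 0` is 1 and `central 3` is 3.
central-step : ∀ n → 2 ≤ n → 4 * central n ≤ central (3 + n)
central-step n 2≤n with even⊎odd n
central-step _ () | zero , inj₁ refl
... | suc j , inj₁ refl = subst₂ (λ k l → 4 * ((2 + j * 2) C k) ≤ (5 + j * 2) C l)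
  (sym (m*n/n≡m (suc j) 2)) (sym (1+2*-/2 (2 + j))) (C-even-step j)
... | j , inj₂ refl = subst₂ (λ k l → 4 * ((1 + j * 2) C k) ≤ (4 + j * 2) C l)
  (sym (1+2*-/2 j)) (sym (m*n/n≡m (2 + j) 2)) (C-odd-step j)

2+4^≤central : ∀ s → 2 + 4 ^ (2 + s) ≤ central (3 * (2 + s))
-- 2 + 4^2 = 18, against C(6, 3) = 20.
2+4^≤central zero    = ℕₚ.m≤m+n 18 2
2+4^≤central (suc s) = begin
  2 + 4 * 4 ^ (2 + s)           ≤⟨ ℕₚ.+-monoˡ-≤ _ (ℕₚ.m≤m+n 2 6) ⟩
  4 * 2 + 4 * 4 ^ (2 + s)       ≡⟨ ℕₚ.*-distribˡ-+ 4 2 (4 ^ (2 + s)) ⟨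
  4 * (2 + 4 ^ (2 + s))         ≤⟨ ℕₚ.*-monoʳ-≤ 4 (2+4^≤central s) ⟩
  4 * central (3 * (2 + s))     ≤⟨ central-step (3 * (2 + s)) (ℕₚ.≤-trans (ℕₚ.m≤m+n 2 s) (ℕₚ.m≤n*m (2 + s) 3)) ⟩
  central (3 + 3 * (2 + s))     ≡⟨ cong central (ℕₚ.*-suc 3 (2 + s)) ⟨
  central (3 * (3 + s))         ∎
  where open ℕₚ.≤-Reasoning

-- With 1 ≤ k the number of pieces is at most 4k, and this 4 is moved into the exponent as the
-- summand 2.
size-bound : ∀ k s → 1 ≤ k → 2 ≤ s → (1 + k * 2) * 2 ^ (2 ^ (s + s)) ≤ k * 2 ^ central (3 * s)
size-bound k (suc zero)       _   (s≤s ())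
size-bound k s@(suc (suc s′)) 1≤k _ = begin
  (1 + k * 2) * 2 ^ (2 ^ (s + s))   ≤⟨ ℕₚ.*-monoˡ-≤ _ (ℕₚ.+-monoˡ-≤ (k * 2) 1≤k) ⟩
  (k + k * 2) * 2 ^ (2 ^ (s + s))   ≤⟨ ℕₚ.*-monoˡ-≤ _ (ℕₚ.≤-trans (ℕₚ.m≤m+n _ k) (ℕₚ.≤-reflexive (k*4 k))) ⟩
  k * 4 * 2 ^ (2 ^ (s + s))         ≡⟨ ℕₚ.*-assoc k 4 _ ⟩
  k * (4 * 2 ^ (2 ^ (s + s)))       ≡⟨ cong (k *_) (ℕₚ.^-distribˡ-+-* 2 2 (2 ^ (s + s))) ⟨
  k * 2 ^ (2 + 2 ^ (s + s))         ≡⟨ cong (λ m → k * 2 ^ (2 + 2 ^ (s + m))) (ℕₚ.+-identityʳ s) ⟨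
  k * 2 ^ (2 + 2 ^ (2 * s))         ≡⟨ cong (λ m → k * 2 ^ (2 + m)) (ℕₚ.^-*-assoc 2 2 s) ⟨
  k * 2 ^ (2 + 4 ^ s)               ≤⟨ ℕₚ.*-monoʳ-≤ k (ℕₚ.^-monoʳ-≤ 2 (2+4^≤central s′)) ⟩
  k * 2 ^ central (3 * s)           ∎
  where
  open ℕₚ.≤-Reasoning
  k*4 : ∀ k → k + k * 2 + k ≡ k * 4
  k*4 = solve-∀

-- From a tree decomposition to the quotient map

-- Lists of a fixed length `s`, padded with a default element, give all pieces the same number of
-- boundary positions although bags differ in size.
enumerate : ∀ {X : Set} {n} (p : Subset n) s → ∣ p ∣ ≤ s → X → (g : Fin n → X) →
            Σ (Fin s → X) λ f → ∀ {v} → v ∈ p → ∃[ i ] f i ≡ g v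
enumerate []          s       le       d g = (λ _ → d) , λ ()
enumerate (false ∷ p) s       le       d g with enumerate p s le d (g ∘ suc)
... | f , onto = f , λ { (there v∈) → onto v∈ }
enumerate (true ∷ p)  (suc s) (s≤s le) d g with enumerate p s le d (g ∘ suc)
... | f , onto = f′ , λ { here → zero , refl ; (there v∈) → let i , eq = onto v∈ in suc i , eq }
  where
  f′ : Fin (suc s) → _
  f′ zero    = g zero
  f′ (suc i) = f i

∣p∣≤1⇒unique : ∀ {n} {p : Subset n} {u v} → ∣ p ∣ ≤ 1 → u ∈ p → v ∈ p → u ≡ v
∣p∣≤1⇒unique {p = p} {u} le u∈ v∈ with enumerate p 1 le u id
... | f , onto with onto u∈ | onto v∈
...   | zero , refl | zero , refl = refl

extension : ∀ {k n} (τ : Fin k ↣ Fin n) U → ∃[ A ] Extends τ U A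
extension τ U = from-preimage (saturated-preimage to U λ eq → cong (lookup U) (injective eq))
  where
  open Injection τ using (to; injective)
  from-preimage : (∃[ A ] preimage to A ≡ U) → ∃[ A ] Extends τ U A
  from-preimage (A , refl) = A , λ i → mk⇔
    (λ i∈ → Vecₚ.lookup⇒[]= i _ (trans (lookup-preimage to A i) (Vecₚ.[]=⇒lookup i∈)))
    (λ i∈ → Vecₚ.lookup⇒[]= _ A (trans (sym (lookup-preimage to A i)) (Vecₚ.[]=⇒lookup i∈)))

module _ (em : ExcludedMiddle 0ℓ) where
  private
    module S = Sums (ℝ-totallyPreorderedMonoid em)
    module P = Pieces (ℝ-totallyPreorderedMonoid em)

  edgeless : ∀ k → Network k
  edgeless k = record
    { graph   = record { Adj = λ _ _ → ⊥ ; adj? = λ _ _ → no id ; adj-sym = id ; adj-irrefl = λ _ → id }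
    ; cap     = λ _ _ → 0ᴿ
    ; cap-sym = λ _ _ ()
    ; cap-pos = λ _ _ ()
    }

  uncrossed-cut : ∀ {n} (G : Network n) A →
    (∀ {e} → e List∈.∈ Network.edges G → ¬ Crosses A e) → Network.cut G A ≃ 0ᴿ
  uncrossed-cut G A ¬cross = S.∑-zero (Network.δ G A) λ e∈ →
    let e∈G , c = List∈ₚ.∈-filter⁻ (Network.crosses? G A) {xs = Network.edges G} e∈ in ⊥-elim (¬cross e∈G c)

  cut-nonneg : ∀ {n} (G : Network n) A → 0ᴿ ≤ᴿ Network.cut G A
  cut-nonneg G A = S.0≤∑ (Network.δ G A) λ e∈ → cap-nonneg em G
      (proj₁ (List∈ₚ.∈-filter⁻ (Network.crosses? G A) {xs = Network.edges G} e∈))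

  -- If every terminal set extends to a cut crossed by no edge, the terminal cut function vanishes
  -- identically, since no cut is negative; bare terminals then suffice. This covers `k = 0` and
  -- `t = 0`.
  edgeless-isMimicking : ∀ {k n} (G : Network n) (τ : Fin k ↣ Fin n) →
    (∀ U → ∃[ A ] (Extends τ U A × (∀ {e} → e List∈.∈ Network.edges G → ¬ Crosses A e))) →
    IsMimicking G τ (edgeless k) (mk↣ {to = id} id)
  edgeless-isMimicking {k} G τ uncrossed U = from (uncrossed U)
    where
    from : (∃[ A ] (Extends τ U A × (∀ {e} → e List∈.∈ Network.edges G → ¬ Crosses A e))) → _
    from (A , ext , ¬cross) = 0ᴿ
      , record { attained = A , ext , uncrossed-cut G A ¬cross ; minimal = λ A′ _ → cut-nonneg G A′ }
      , record { attained = U , (λ i → mk⇔ id id)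
                          , uncrossed-cut (edgeless k) U λ e∈ _ → proj₂ (∈-edges⁻ (Network.graph (edgeless k)) e∈)
               ; minimal = λ A′ _ → cut-nonneg (edgeless k) A′ }

  module _ {n t k : ℕ} (G : Network n) (τ : Fin k ↣ Fin n) (D : TreeDecomposition (Network.graph G))
           (bag-size : ∀ i → ∣ TreeDecomposition.bag D i ∣ ≤ suc t) where
    open TreeDecomposition D
    open Injection τ using (to)
    open Graph (Network.graph G)

    treewidth-0-edgeless : t ≡ 0 → ∀ {e} → ¬ (e List∈.∈ edges)
    treewidth-0-edgeless refl {u , v} e∈ with ∈-edges⁻ (Network.graph G) e∈
    ... | _ , uv with covers-edges u v uv
    ...   | i , u∈ , v∈ = adj-irrefl (∣p∣≤1⇒unique (bag-size i) u∈ v∈) uv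

    node : Fin n → Fin size
    node v = proj₁ (covers-vertices v)

    edgeNode′ : ∀ {u v} → Dec (Adj u v) → Fin size
    edgeNode′ {u} {v} (yes uv) = proj₁ (covers-edges u v uv)
    edgeNode′ {u} {v} (no _)   = node u

    edgeNode : Fin n × Fin n → Fin size
    edgeNode (u , v) = edgeNode′ (adj? u v)

    edgeNode-covers : ∀ {u v} (d : Dec (Adj u v)) → Adj u v → u ∈ bag (edgeNode′ d) × v ∈ bag (edgeNode′ d)
    edgeNode-covers {u} {v} (yes uv) _  = proj₂ (covers-edges u v uv)
    edgeNode-covers         (no ¬uv) uv = ⊥-elim (¬uv uv)

    open Medians.Partition (Medians.partition tree isTree em k (node ∘ to))

    N : ℕ
    N = (1 + k * 2) * 2 ^ (2 ^ (suc t + suc t))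

    module _ (default : Fin n) where

      bagEnum : ∀ i → Σ (Fin (suc t) → Fin n) λ f → ∀ {v} → v ∈ bag i → ∃[ j ] f j ≡ v
      bagEnum i = enumerate (bag i) (suc t) (bag-size i) default id

      boundary : Fin (1 + k * 2) → Fin (suc t + suc t) → Fin n
      boundary p = [ proj₁ (bagEnum (β₁ p)) , proj₁ (bagEnum (β₂ p)) ]′ ∘ splitAt (suc t)

      pieceOf : Fin n → Fin (1 + k * 2)
      pieceOf = piece ∘ node

      edgePiece : Fin n × Fin n → Fin (1 + k * 2)
      edgePiece = piece ∘ edgeNode

      weight : Fin n × Fin n → ℝ
      weight = uncurry (Network.cap G)

      OnBoundary : Fin (1 + k * 2) → Fin n → Set
      OnBoundary p v = ∃[ i ] boundary p i ≡ v

      end-boundary : ∀ {p i v} → IsEnd p i → v ∈ bag i → OnBoundary p v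
      end-boundary {p} (inj₁ refl) v∈ = let j , eq = proj₂ (bagEnum (β₁ p)) v∈ in
        j ↑ˡ suc t , trans (cong [ _ , _ ]′ (Finₚ.splitAt-↑ˡ (suc t) j (suc t))) eq
      end-boundary {p} (inj₂ refl) v∈ = let j , eq = proj₂ (bagEnum (β₂ p)) v∈ in
        suc t ↑ʳ j , trans (cong [ _ , _ ]′ (Finₚ.splitAt-↑ʳ (suc t) (suc t) j)) eq

      -- Where the walk first changes piece, `separated` makes one node of the tree edge an end of
      -- the piece being left, and the bags of both nodes contain `v`.
      leaves-through-boundary : ∀ {v i j} → Star (λ a b → Graph.Adj tree a b × v ∈ bag a × v ∈ bag b) i j →
        piece i ≡ piece j ⊎ OnBoundary (piece i) v
      leaves-through-boundary Star.ε = inj₁ refl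
      leaves-through-boundary {v} (_◅_ {i} {j} (e , v∈i , v∈j) s) with piece i Fin.≟ piece j
      ... | no pi≢pj = inj₂ ([ (λ end → end-boundary end v∈i) , (λ end → end-boundary end v∈j) ]′ (separated e pi≢pj))
      ... | yes pi≡pj with leaves-through-boundary s
      ...   | inj₁ eq = inj₁ (trans pi≡pj eq)
      ...   | inj₂ v∈ = inj₂ (subst (λ p → OnBoundary p v) (sym pi≡pj) v∈)

      -- A walk out of a piece only yields the boundary of the piece it starts from, so the bags
      -- containing `v` are traversed in both directions.
      inPiece : ∀ {v i} → v ∈ bag i →
        pieceOf v ≡ piece i ⊎ (OnBoundary (piece i) v × OnBoundary (pieceOf v) v)
      inPiece {v} {i} v∈ with proj₂ (covers-vertices v)
      ... | v∈′ with leaves-through-boundary (coherent v i (node v) v∈ v∈′)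
                   | leaves-through-boundary (coherent v (node v) i v∈′ v∈)
      ...   | inj₁ eq | _       = inj₁ (sym eq)
      ...   | inj₂ _  | inj₁ eq = inj₁ eq
      ...   | inj₂ b  | inj₂ b′ = inj₂ (b , b′)

      terminal-boundary : ∀ j → OnBoundary (pieceOf (to j)) (to j)
      terminal-boundary j = end-boundary (mark-isEnd j) (proj₂ (covers-vertices (to j)))

      vertexKey : Fin n → Fin N
      vertexKey = P.key (Network.graph G) weight pieceOf edgePiece boundary

      canonicalise : Subset n → Subset n
      canonicalise = P.canonical (Network.graph G) weight pieceOf edgePiece boundary

      canonicalise-cut : ∀ A → Network.cut G (canonicalise A) ≤ᴿ Network.cut G A
      canonicalise-cut = P.canonical-cut (Network.graph G) weight pieceOf edgePiece boundary edge-inPiece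
        where
        edge-inPiece : ∀ {u v} → (u , v) List∈.∈ edges → _ × _
        edge-inPiece {u} {v} e∈ =
          let u∈ , v∈ = edgeNode-covers (adj? u v) (proj₂ (∈-edges⁻ (Network.graph G) e∈)) in
          inPiece u∈ , inPiece v∈

      canonicalise-extends : ∀ {U A} → Extends τ U A → Extends τ U (canonicalise A)
      canonicalise-extends {U} {A} ext i = mk⇔
        (λ i∈ → Equivalence.to (ext i) (Vecₚ.lookup⇒[]= _ A (trans (sym same) (Vecₚ.[]=⇒lookup i∈))))
        (λ i∈ → Vecₚ.lookup⇒[]= _ (canonicalise A)
          (trans same (Vecₚ.[]=⇒lookup (Equivalence.from (ext i) i∈))))
        where
        same : lookup (canonicalise A) (to i) ≡ lookup A (to i)
        same = P.canonical-boundary (Network.graph G) weight pieceOf edgePiece boundary A (terminal-boundary i)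

      saturatedMinCut : ∀ U → ∃[ A ] (IsMinCut em G τ U A × Saturated vertexKey A)
      saturatedMinCut U = from (P.minimiser? (Extends τ U) (λ _ → em) (Network.cut G))
        where
        from : P.Minimiser (Extends τ U) (Network.cut G) ⊎ (∀ A → ¬ Extends τ U A) →
               ∃[ A ] (IsMinCut em G τ U A × Saturated vertexKey A)
        from (inj₂ ¬ext) = ⊥-elim (uncurry ¬ext (extension τ U))
        from (inj₁ (A , ext , min)) = canonicalise A
          , (canonicalise-extends ext , λ A′ ext′ →
               ≤ᴿ-trans {Network.cut G (canonicalise A)} {Network.cut G A} {Network.cut G A′}
                 (canonicalise-cut A) (min A′ ext′))
          , P.canonical-saturated (Network.graph G) weight pieceOf edgePiece boundary A

    mimicking : 1 ≤ k → 1 ≤ t → ∃ λ (N : ℕ) → Σ (Network N) λ H → Σ (Fin k ↣ Fin N) λ σ →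
      N ≤ k * 2 ^ ((3 * (t + 1)) C ((3 * (t + 1)) / 2)) × IsMimicking G τ H σ
    mimicking 1≤k 1≤t = N , quotient em G q , quotientTerminals em G τ q minCut
      , subst (λ s → N ≤ k * 2 ^ central (3 * s)) (ℕₚ.+-comm 1 t) (size-bound k (suc t) 1≤k (s≤s 1≤t))
      , quotient-isMimicking em G τ q minCut
      where
      -- Padding for the bag lists; the first terminal serves as an available vertex.
      default = to (Fin.fromℕ< 1≤k)
      q = vertexKey default
      minCut = saturatedMinCut default

corollary3p6 : ExcludedMiddle 0ℓ →
    ∀ (n t k : ℕ) (G : Network n) (τ : Fin k ↣ Fin n) →
    HasTreewidth (Network.graph G) t →
    ∃ λ (N : ℕ) → Σ (Network N) λ H → Σ (Fin k ↣ Fin N) λ σ →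
    N ≤ k * 2 ^ ((3 * (t + 1)) C ((3 * (t + 1)) / 2)) × IsMimicking G τ H σ
-- The bound is 0, so the network must be empty; the only terminal set is realised by the empty cut,
-- which no edge crosses.
corollary3p6 em n t zero G τ _ = 0 , edgeless em 0 , mk↣ {to = id} id , z≤n
  , edgeless-isMimicking em G τ λ { Vec.[] → tabulate (λ _ → false) , (λ ())
      , λ {(u , v)} _ c → c (trans (Vecₚ.lookup∘tabulate _ u) (sym (Vecₚ.lookup∘tabulate _ v))) }
corollary3p6 em n zero (suc k) G τ ((D , bag-size , _) , _) = suc k , edgeless em (suc k) , mk↣ {to = id} id
  -- For `t = 0` the factor in the bound is 2^C(3, 1) = 8.
  , ℕₚ.m≤m*n (suc k) 8
  , edgeless-isMimicking em G τ λ U → let A , ext = extension τ U in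
      A , ext , λ e∈ _ → treewidth-0-edgeless em G τ D bag-size refl e∈
corollary3p6 em n (suc t) (suc k) G τ ((D , bag-size , _) , _) =
  mimicking em G τ D bag-size (s≤s z≤n) (s≤s z≤n)
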